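{- Let $k \geqslant 2$ be a fixed integer. There exists $n_0 = n_0(k)$ such that for every integer $n \geqslant n_0$ and every positive integer $q$ the following hold for the $(1:q)$ Waiter--Client $k$--SAT game played on the set $\mathcal{C}^{(k)}_n$ of all $k$--clauses over $n$ boolean variables. (i) If $q \leqslant \binom{n}{k}/(2n)$, then Waiter has a strategy ensuring that the conjunction of all $k$--clauses claimed by Client by the end of the game is not satisfiable. (ii) If $q \geqslant 2^{3k/2}e^{k/2+1}k\binom{n}{k}/n$, then Client has a strategy ensuring that the conjunction of all $k$--clauses he claims remains satisfiable throughout the game.
   Context: Fix boolean variables $x_1,\ldots,x_n$. A literal is a variable $x_i$ or its negation $\neg x_i$. A $k$--clause is the disjunction of exactly $k$ non--complementary literals, i.e. of $k$ literals belonging to $k$ distinct variables (clauses are identified with their sets of literals). $\mathcal{C}^{(k)}_n$ denotes the set of all $2^k\binom{n}{k}$ possible $k$--clauses over $x_1,\ldots,x_n$. A conjunction of $k$--clauses is satisfiable if some $\{0,1\}$--assignment to the variables makes every clause true. The $(1:q)$ Waiter--Client game $(X,\mathcal{F})$, where $X$ is a finite set (the board), $\mathcal{F}$ is the family of winning sets (subsets of $X$) and $q$ is a positive integer, is the following two--player perfect information game. At the beginning of each round, Waiter offers Client exactly $q+1$ free (that is, previously unclaimed) elements of $X$ of Waiter's choice. Client claims one of these, and the remaining $q$ offered elements are claimed by Waiter. If in the last round only $1\leqslant r<q+1$ free elements remain, Waiter claims all of them. The game ends when all elements of $X$ are claimed. Waiter wins if Client has fully claimed some winning set in $\mathcal{F}$;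 otherwise Client wins. The $k$--SAT game has board $X=\mathcal{C}^{(k)}_n$, and its winning sets are the sets $\mathcal{S}\subseteq\mathcal{C}^{(k)}_n$ whose conjunction $\bigwedge\mathcal{S}$ is not satisfiable. Here $e$ is the base of the natural logarithm. -}

module Defs where

open import Data.Bool using (Bool; true; false)
open import Data.Fin using (Fin)
open import Data.Integer using (+_)
open import Data.List using (List; []; _∷_; _++_; length; filter; cartesianProductWith)
open import Data.List.Membership.Propositional using (_∈_)
open import Data.List.Membership.Propositional.Properties
  using (∈-cartesianProductWith⁺; ∈-filter⁺; ∈-filter⁻)
open import Data.List.Relation.Binary.Permutation.Propositional using (_↭_)
open import Data.List.Relation.Unary.All using (All; []; _∷_)
open import Data.List.Relation.Unary.AllPairs using ([]; _∷_)
open import Data.List.Relation.Unary.Any using (here; there)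
open import Data.List.Relation.Unary.Unique.Propositional using (Unique)
import Data.List.Relation.Unary.Unique.Propositional.Properties as Unique
open import Data.Maybe using (Maybe; just; nothing; is-just)
open import Data.Nat as ℕ using (ℕ; zero; suc; _!)
open import Data.Nat.Properties using (_≟_; _!≢0)
open import Data.Product using (∃; ∃₂; _×_; _,_; proj₁; proj₂)
open import Data.Rational.Unnormalised as ℚ using (ℚᵘ; _/_; 0ℚᵘ; 1ℚᵘ)
open import Data.Sum using (_⊎_)
open import Data.Vec using (Vec; []; _∷_; lookup; countᵇ)
open import Data.Vec.Properties using (∷-injective)
open import Function using (_⇔_; mk⇔; _∘_)
open import Relation.Binary.PropositionalEquality using (_≡_; refl)
open import Relation.Nullary using (¬_)

-- (i , true) is the variable xᵢ and (i , false) is its negation.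
Literal : ℕ → Set
Literal n = Fin n × Bool

-- A set of pairwise non-complementary literals is recorded by stating, for each
-- variable, whether it is absent (nothing) or which of its two literals
-- is present; so _≡_ on clauses is equality of literal sets.
Clause : ℕ → Set
Clause n = Vec (Maybe Bool) n

_∈ᶜ_ : ∀ {n} → Literal n → Clause n → Set
(i , b) ∈ᶜ c = lookup c i ≡ just b

width : ∀ {n} → Clause n → ℕ
width = countᵇ is-just

clauses : ∀ n → List (Clause n)
clauses zero    = [] ∷ []
clauses (suc n) = cartesianProductWith _∷_ (nothing ∷ just false ∷ just true ∷ []) (clauses n)

kClauses : ∀ k n → List (Clause n)
kClauses k n = filter (λ c → width c ≟ k) (clauses n)

∈-clauses : ∀ {n} (c : Clause n) → c ∈ clauses n
∈-clauses []      = here refl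
∈-clauses (x ∷ c) = ∈-cartesianProductWith⁺ _∷_ (∈-entries x) (∈-clauses c)
  where
  ∈-entries : ∀ x → x ∈ (nothing ∷ just false ∷ just true ∷ [])
  ∈-entries nothing      = here refl
  ∈-entries (just false) = there (here refl)
  ∈-entries (just true)  = there (there (here refl))

clauses-unique : ∀ n → Unique (clauses n)
clauses-unique zero    = [] ∷ []
clauses-unique (suc n) = Unique.cartesianProductWith⁺ _∷_ ∷-injective
  (((λ ()) ∷ (λ ()) ∷ []) ∷ ((λ ()) ∷ []) ∷ [] ∷ []) (clauses-unique n)

∈-kClauses : ∀ {k n} {c : Clause n} → c ∈ kClauses k n ⇔ width c ≡ k
∈-kClauses {k} {n} {c} = mk⇔
  (proj₂ ∘ ∈-filter⁻ (λ c → width c ≟ k) {xs = clauses n})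
  (∈-filter⁺ (λ c → width c ≟ k) (∈-clauses c))

kClauses-unique : ∀ k n → Unique (kClauses k n)
kClauses-unique k n = Unique.filter⁺ (λ c → width c ≟ k) (clauses-unique n)

Assignment : ℕ → Set
Assignment n = Vec Bool n

TrueLiteral : ∀ {n} → Assignment n → Literal n → Set
TrueLiteral σ (i , b) = lookup σ i ≡ b

TrueClause : ∀ {n} → Assignment n → Clause n → Set
TrueClause σ c = ∃ λ l → l ∈ᶜ c × TrueLiteral σ l

Satisfiable : ∀ {n} → List (Clause n) → Set
Satisfiable S = ∃ λ σ → All (TrueClause σ) S

------------------------------------------------------------------------
-- The (1 : q) Waiter–Client game.  A finite set is a duplicate-free list.
-- Only the free elements and those claimed by Client are tracked: all
-- others belong to Waiter.

module WaiterClient {X : Set} (q : ℕ) where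

  record Offer (free : List X) : Set where
    field
      offered rest : List X
      split        : free ↭ offered ++ rest
      size         : length offered ≡ suc q

  open Offer public

  -- Strategies are trees, so each decision may depend on the whole history.
  -- Waiter stops only when at most q elements are free; he then claims them all.
  data WaiterStrategy (free : List X) : Set where
    stop  : length free ℕ.≤ q → WaiterStrategy free
    offer : (o : Offer free) →
            (∀ {x} → x ∈ offered o → WaiterStrategy (rest o)) →
            WaiterStrategy free

  -- FinalClaim σ S: in some complete play in which Waiter follows σ, the
  -- elements claimed by Client are S, in the order of claiming.
  data FinalClaim : ∀ {free} → WaiterStrategy free → List X → Set where
    stop  : ∀ {free} {small : length free ℕ.≤ q} → FinalClaim {free} (stop small) []
    round : ∀ {free} {o : Offer free}
              {next : ∀ {x} → x ∈ offered o → WaiterStrategy (rest o)} {x S}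
            (x∈ : x ∈ offered o) → FinalClaim (next x∈) S →
            FinalClaim (offer o next) (x ∷ S)

  -- When at most q elements are free there is no Offer, and Client has
  -- nothing left to decide.
  data ClientStrategy (free : List X) : Set where
    respond : ((o : Offer free) → ∃ λ x → x ∈ offered o × ClientStrategy (rest o)) →
              ClientStrategy free

  -- Claim τ S: in some play in which Client follows τ, the elements he has
  -- claimed after some number of rounds (not necessarily all) are S.
  data Claim : ∀ {free} → ClientStrategy free → List X → Set where
    now   : ∀ {free} {τ : ClientStrategy free} → Claim τ []
    round : ∀ {free}
              {f : (o : Offer free) → ∃ λ x → x ∈ offered o × ClientStrategy (rest o)} {S}
            (o : Offer free) → Claim (proj₂ (proj₂ (f o))) S →
            Claim (respond f) (proj₁ (f o) ∷ S)

open WaiterClient public using (WaiterStrategy; FinalClaim; ClientStrategy; Claim)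

------------------------------------------------------------------------
-- Nonnegative reals as lower Dedekind cuts: α s means s < α,
-- so α ≤ r is the failure of r < α.

Cut : Set₁
Cut = ℚᵘ → Set

infix  4 _≤ᶜ_
infixl 7 _·_
infixr 8 _^_
infix  9 √_

_≤ᶜ_ : Cut → ℚᵘ → Set
α ≤ᶜ r = ¬ α r

rat : ℚᵘ → Cut
rat r s = s ℚ.< r

nat : ℕ → Cut
nat m = rat (+ m / 1)

_·_ : Cut → Cut → Cut
(α · β) s = s ℚ.< 0ℚᵘ ⊎
  ∃₂ λ a b → 0ℚᵘ ℚ.≤ a × α a × 0ℚᵘ ℚ.≤ b × β b × s ℚ.< a ℚ.* b

_^_ : Cut → ℕ → Cut
α ^ zero  = nat 1
α ^ suc m = α · α ^ m

√_ : Cut → Cut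
(√ α) s = s ℚ.< 0ℚᵘ ⊎ α (s ℚ.* s)

expSum : ℕ → ℚᵘ
expSum zero    = 1ℚᵘ
expSum (suc N) = expSum N ℚ.+ (+ 1 / (suc N !)) {{suc N !≢0}}

-- e as the supremum of the partial sums of Σ 1/i!
e : Cut
e s = ∃ λ N → s ℚ.< expSum N

{-# OPTIONS --safe #-}
-- (i) Waiter keeps the assignments τ satisfying all clauses claimed so far and gives τ the weight
-- ((9q−4)/9q)^r, where r is the number of free clauses falsified by τ.  He offers q + 1 clauses for
-- which the total weights of the assignments falsifying them agree up to a factor 5/4; whichever of
-- them Client claims, the total weight does not increase.  Such an offer exists as long as every
-- surviving assignment falsifies more than 5q free clauses.  An assignment with at most 5q of them
-- would be heavier than the initial total weight, because 2ⁿ ((9q−4)/9q)^(C(n,k)−5q) < 1 for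
-- large n, so no assignment survives.
--
-- (ii) Call a cyclic sequence of distinct clauses a cycle if consecutive clauses share a variable and
-- consecutive shared variables differ.  A formula without cycles is satisfiable: following a walk that
-- always leaves a clause through a new variable, one gets stuck at a clause with a private variable,
-- which can be removed and satisfied at the end.  Any two variables occur together in
-- D = 2^k C(n−2,k−2) clauses, so there are at most (nD)^s cycles of length s, and nD ≤ q/2.  Hence
-- Σ_s (nD)^s (q+1)^(−s) < 1, and Client avoids all cycles by making each choice at least as good as a
-- uniformly random one.
module Submission where

open import Defs
open import Data.Bool using (Bool; true; false; not; _∧_; if_then_else_; T)
import Data.Bool.Properties as Bool
open import Data.Empty using (⊥; ⊥-elim)
open import Data.Fin using (Fin; zero; suc)
import Data.Fin.Properties as Fin
open import Data.List
  using (List; []; _∷_; _++_; length; [_]; filter; filterᵇ; map; take; drop; concatMap;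
    cartesianProductWith; allFin; deduplicate)
open import Data.List.Membership.Propositional using (_∈_)
import Data.List.Membership.DecPropositional as DecMembership
open import Data.List.Membership.Propositional.Properties
open import Data.List.Properties
  using (length-take; take++drop≡id; length-++; length-map; length-tabulate; ++-assoc)
open import Data.List.Relation.Binary.Permutation.Propositional
  using (_↭_; refl; prep; swap; ↭-refl; ↭-reflexive; ↭-sym; ↭-trans; ↭⇒↭ₛ)
import Data.List.Relation.Binary.Permutation.Propositional as ↭
open import Data.List.Relation.Binary.Permutation.Propositional.Properties
  using (shift; shifts; ++⁺ˡ; ↭-length; ∈-resp-↭; All-resp-↭)
import Data.List.Relation.Binary.Permutation.Setoid.Properties as Permutation
open import Data.List.Relation.Unary.All using (All; []; _∷_)
import Data.List.Relation.Unary.All as All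
import Data.List.Relation.Unary.All.Properties as All
open import Data.List.Relation.Unary.AllPairs using ([]; _∷_)
open import Data.List.Relation.Unary.Any using (Any; here; there)
import Data.List.Relation.Unary.Any as Any
import Data.List.Relation.Unary.Unique.DecPropositional.Properties as DecUnique
open import Data.List.Relation.Unary.Unique.Propositional using (Unique)
import Data.List.Relation.Unary.Unique.Propositional.Properties as Unique
open import Data.Maybe using (Maybe; just; nothing; is-just)
import Data.Maybe.Properties as Maybe
open import Data.Nat hiding (_^_; _/_; _!)
open import Data.Nat using () renaming (_^_ to _^ᴺ_)
open import Data.Nat.Combinatorics
  using (_C_; nC1≡n; nCn≡1; nCk≡nC[n∸k]; nCk+nC[k+1]≡[n+1]C[k+1]; k>n⇒nCk≡0)
import Data.Nat.DivMod as ℕ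
open import Data.Nat.Properties
open import Data.Nat.Tactic.RingSolver using (solve-∀)
open import Data.Product using (∃; ∃₂; _×_; _,_; proj₁; proj₂)
open import Data.Sum using (_⊎_; inj₁; inj₂)
open import Data.Vec using (Vec; []; _∷_; lookup; replicate; _[_]≔_)
import Data.Vec.Properties as Vec
open import Function using (_∘_; Equivalence)
open import Relation.Binary.Definitions using (DecidableEquality)
open import Relation.Binary.PropositionalEquality hiding ([_])
open import Relation.Nullary using (¬_; does; yes; no)
open import Relation.Nullary.Decidable using (from-yes)
open import Relation.Unary using (Decidable)

private variable
  X Y Z : Set

-- Finite sums

∑ : (X → ℕ) → List X → ℕ
∑ f []       = 0
∑ f (x ∷ xs) = f x + ∑ f xs

∑-cong : ∀ {f g : X → ℕ} → (∀ x → f x ≡ g x) → ∀ xs → ∑ f xs ≡ ∑ g xs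
∑-cong f≡g []       = refl
∑-cong f≡g (x ∷ xs) = cong₂ _+_ (f≡g x) (∑-cong f≡g xs)

∑-mono : ∀ {f g : X → ℕ} xs → (∀ {x} → x ∈ xs → f x ≤ g x) → ∑ f xs ≤ ∑ g xs
∑-mono []       f≤g = z≤n
∑-mono (x ∷ xs) f≤g = +-mono-≤ (f≤g (here refl)) (∑-mono xs λ x∈ → f≤g (there x∈))

∑-++ : ∀ (f : X → ℕ) xs ys → ∑ f (xs ++ ys) ≡ ∑ f xs + ∑ f ys
∑-++ f []       ys = refl
∑-++ f (x ∷ xs) ys = trans (cong (f x +_) (∑-++ f xs ys)) (sym (+-assoc (f x) _ _))

∑-map : ∀ (f : Y → ℕ) (g : X → Y) xs → ∑ f (map g xs) ≡ ∑ (λ x → f (g x)) xs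
∑-map f g []       = refl
∑-map f g (x ∷ xs) = cong (f (g x) +_) (∑-map f g xs)

+-swap : ∀ a b c d → (a + b) + (c + d) ≡ (a + c) + (b + d)
+-swap = solve-∀

∑-+ : ∀ (f g : X → ℕ) xs → ∑ (λ x → f x + g x) xs ≡ ∑ f xs + ∑ g xs
∑-+ f g []       = refl
∑-+ f g (x ∷ xs) = trans (cong (f x + g x +_) (∑-+ f g xs)) (+-swap (f x) (g x) _ _)

∑-* : ∀ a (f : X → ℕ) xs → ∑ (λ x → a * f x) xs ≡ a * ∑ f xs
∑-* a f []       = sym (*-zeroʳ a)
∑-* a f (x ∷ xs) = trans (cong (a * f x +_) (∑-* a f xs)) (sym (*-distribˡ-+ a (f x) _))

∑-const : ∀ a (xs : List X) → ∑ (λ _ → a) xs ≡ length xs * a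
∑-const a []       = refl
∑-const a (x ∷ xs) = cong (a +_) (∑-const a xs)

∑-zero : ∀ (xs : List X) → ∑ (λ _ → 0) xs ≡ 0
∑-zero xs = trans (∑-const 0 xs) (*-zeroʳ (length xs))

∑-swap : ∀ (f : X → Y → ℕ) xs ys →
         ∑ (λ x → ∑ (f x) ys) xs ≡ ∑ (λ y → ∑ (λ x → f x y) xs) ys
∑-swap f []       ys = sym (∑-zero ys)
∑-swap f (x ∷ xs) ys = trans (cong (∑ (f x) ys +_) (∑-swap f xs ys)) (sym (∑-+ (f x) _ ys))

∑-↭ : ∀ (f : X → ℕ) {xs ys} → xs ↭ ys → ∑ f xs ≡ ∑ f ys
∑-↭ f refl           = refl
∑-↭ f (prep x p)     = cong (f x +_) (∑-↭ f p)
∑-↭ f (swap x y p)   = trans (cong (λ s → f x + (f y + s)) (∑-↭ f p)) (+-left-comm (f x) (f y) _)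
  where
  +-left-comm : ∀ a b c → a + (b + c) ≡ b + (a + c)
  +-left-comm = solve-∀
∑-↭ f (↭.trans p r)  = trans (∑-↭ f p) (∑-↭ f r)

∑-bound : ∀ (f : X → ℕ) a xs → (∀ {x} → x ∈ xs → f x ≤ a) → ∑ f xs ≤ length xs * a
∑-bound f a xs f≤a = ≤-trans (∑-mono xs f≤a) (≤-reflexive (∑-const a xs))

∈-≤∑ : ∀ (f : X → ℕ) {x xs} → x ∈ xs → f x ≤ ∑ f xs
∈-≤∑ f (here refl) = m≤m+n _ _
∈-≤∑ f (there x∈)  = ≤-trans (∈-≤∑ f x∈) (m≤n+m _ _)

average : ∀ (f : X → ℕ) a x xs → ∑ f (x ∷ xs) ≤ length (x ∷ xs) * a →
          ∃ λ y → y ∈ x ∷ xs × f y ≤ a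
average f a x xs total with f x ≤? a
... | yes fx≤a = x , here refl , fx≤a
average f a x []       total | no fx≰a = x , here refl ,
  subst (_≤ a) (+-identityʳ _) (subst (f x + 0 ≤_) (+-identityʳ a) total)
average f a x (y ∷ ys) total | no fx≰a
  with average f a y ys (+-cancelˡ-≤ a _ _ (≤-trans (+-monoˡ-≤ _ (<⇒≤ (≰⇒> fx≰a))) total))
... | z , z∈ , fz≤a = z , there z∈ , fz≤a

𝟙 : Bool → ℕ
𝟙 b = if b then 1 else 0

𝟙≤1 : ∀ b → 𝟙 b ≤ 1
𝟙≤1 false = z≤n
𝟙≤1 true  = ≤-refl

hits : (X → Bool) → List X → ℕ
hits p = ∑ (λ x → 𝟙 (p x))

hits-≤ : ∀ (p : X → Bool) xs → hits p xs ≤ length xs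
hits-≤ p xs = ≤-trans (∑-bound _ 1 xs λ {x} _ → 𝟙≤1 (p x)) (≤-reflexive (*-identityʳ _))

∑-filterᵇ : ∀ (f : X → ℕ) p xs → ∑ f (filterᵇ p xs) ≡ ∑ (λ x → 𝟙 (p x) * f x) xs
∑-filterᵇ f p []       = refl
∑-filterᵇ f p (x ∷ xs) with p x
... | true  = cong₂ _+_ (sym (+-identityʳ (f x))) (∑-filterᵇ f p xs)
... | false = ∑-filterᵇ f p xs

≤-by : ∀ {a b} c → a + c ≡ b → a ≤ b
≤-by c eq = m+n≤o⇒m≤o _ (≤-reflexive eq)

-- Waiter forces Client to meet every set of a family

separate : {P : X → Set} → Decidable P → ∀ xs →
           ∃₂ λ ys zs → xs ↭ ys ++ zs × All P ys × All (λ x → ¬ P x) zs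
separate P? [] = [] , [] , refl , [] , []
separate P? (x ∷ xs) with P? x | separate P? xs
... | yes px | ys , zs , p , all , none = x ∷ ys , zs , prep x p , px ∷ all , none
... | no ¬px | ys , zs , p , all , none =
  ys , x ∷ zs , ↭-trans (prep x p) (↭-sym (shift x ys zs)) , all , ¬px ∷ none

-- A suitable offer: `ys` is offered, `zs` stays free, and `f` varies on `ys` by a factor of at most
-- 5/4.
Block : ℕ → (X → ℕ) → List X → Set
Block q f xs = ∃₂ λ ys zs → xs ↭ ys ++ zs × length ys ≡ suc q ×
               (∀ {x y} → x ∈ ys → y ∈ ys → 4 * f x ≤ 5 * f y)

-- The elements above 4/5 of the bound B form a block unless there are at most q of them; the
-- others are bounded by 4B/5, so that without a block the sum is at most q (B + 4B/5 + …) = 5qB.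
block : ∀ q (f : X → ℕ) fuel B xs → B ≤ fuel → (∀ {x} → x ∈ xs → f x ≤ B) →
        Block q f xs ⊎ ∑ f xs ≤ 5 * (q * B)
block q f fuel zero xs _ f≤B = inj₂ (≤-trans (∑-bound f 0 xs f≤B)
  (≤-trans (≤-reflexive (*-zeroʳ (length xs))) z≤n))
block q f (suc fuel) B@(suc b) xs (s≤s b≤fuel) f≤B
  with separate (λ x → 4 * B <? 5 * f x) xs
... | ys , zs , xs↭ , high , low with suc q ≤? length ys
... | yes q<|ys| = inj₁ (take (suc q) ys , drop (suc q) ys ++ zs , xs↭′ ,
        trans (length-take (suc q) ys) (m≤n⇒m⊓n≡m q<|ys|) , ratio)
  where
  xs↭′ : xs ↭ take (suc q) ys ++ (drop (suc q) ys ++ zs)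
  xs↭′ = ↭-trans xs↭ (↭-reflexive (trans (cong (_++ zs) (sym (take++drop≡id (suc q) ys)))
    (++-assoc (take (suc q) ys) _ zs)))
  in-ys : ∀ {x} → x ∈ take (suc q) ys → x ∈ ys
  in-ys x∈ = subst (_ ∈_) (take++drop≡id (suc q) ys) (∈-++⁺ˡ x∈)
  ratio : ∀ {x y} → x ∈ take (suc q) ys → y ∈ take (suc q) ys → 4 * f x ≤ 5 * f y
  ratio x∈ y∈ = ≤-trans
    (*-monoʳ-≤ 4 (f≤B (∈-resp-↭ (↭-sym xs↭) (∈-++⁺ˡ (in-ys x∈)))))
    (<⇒≤ (All.lookup high (in-ys y∈)))
-- The at most `q` high elements are set aside, and the search continues among the low ones with the
-- bound ⌊4B/5⌋ < B. A block found there simply leaves the high elements free.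
... | no q≮|ys| = go (block q f fuel B′ zs (≤-trans B′≤b b≤fuel) f≤B′)
  where
  B′ = (4 * B) ℕ./ 5
  B′≤b : B′ ≤ b
  B′≤b = ≤-pred (ℕ.m<n*o⇒m/o<n (subst (4 * B <_) (*-comm 5 B) (*-monoˡ-< B {4} {5} ≤-refl)))
  f≤B′ : ∀ {x} → x ∈ zs → f x ≤ B′
  f≤B′ {x} x∈ = subst (_≤ B′) (ℕ.m*n/n≡m (f x) 5)
    (ℕ./-monoˡ-≤ 5 (subst (_≤ 4 * B) (*-comm 5 (f x)) (≮⇒≥ (All.lookup low x∈))))
  sum≤ : ∑ f zs ≤ 5 * (q * B′) → ∑ f xs ≤ 5 * (q * B)
  sum≤ zs≤ = begin
    ∑ f xs                 ≡⟨ trans (∑-↭ f xs↭) (∑-++ f ys zs) ⟩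
    ∑ f ys + ∑ f zs        ≤⟨ +-mono-≤ (∑-bound f B ys λ x∈ → f≤B (∈-resp-↭ (↭-sym xs↭) (∈-++⁺ˡ x∈))) zs≤ ⟩
    length ys * B + 5 * (q * B′) ≤⟨ +-monoˡ-≤ _ (*-monoˡ-≤ B (≤-pred (≰⇒> q≮|ys|))) ⟩
    q * B + 5 * (q * B′)   ≡⟨ cong (q * B +_) (move q B′) ⟩
    q * B + q * (B′ * 5)   ≤⟨ +-monoʳ-≤ (q * B) (*-monoʳ-≤ q (ℕ.m/n*n≤m (4 * B) 5)) ⟩
    q * B + q * (4 * B)    ≡⟨ collect q B ⟩
    5 * (q * B)            ∎
    where
    open ≤-Reasoning
    move : ∀ q B → 5 * (q * B) ≡ q * (B * 5)
    move = solve-∀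
    collect : ∀ q B → q * B + q * (4 * B) ≡ 5 * (q * B)
    collect = solve-∀
  go : Block q f zs ⊎ ∑ f zs ≤ 5 * (q * B′) → Block q f xs ⊎ ∑ f xs ≤ 5 * (q * B)
  go (inj₂ zs≤) = inj₂ (sum≤ zs≤)
  go (inj₁ (as , bs , zs↭ , size , ratio)) = inj₁ (as , ys ++ bs ,
    ↭-trans xs↭ (↭-trans (++⁺ˡ ys zs↭) (shifts ys as)) , size , ratio)

∈-↭-∷ : ∀ {x : X} {xs} → x ∈ xs → ∃ λ ys → xs ↭ x ∷ ys
∈-↭-∷ x∈ with ∈-∃++ x∈
... | ys , zs , refl = ys ++ zs , shift _ ys zs

module Transversal (hit : Y → X → Bool) (p : ℕ) where

  -- With `p` = `q` - 1, the number `α` = 9`q` - 4 needs no truncated subtraction. Each free element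
  -- hit by `y` contributes a factor `α`/`β` to the weight of `y`.
  q α β : ℕ
  q = suc p
  α = 9 * p + 5
  β = 9 * q

  β≡α+4 : β ≡ α + 4
  β≡α+4 = eq p
    where
    eq : ∀ p → 9 * suc p ≡ 9 * p + 5 + 4
    eq = solve-∀

  instance
    α≢0 : NonZero α
    α≢0 = >-nonZero (≤-trans (s≤s z≤n) (m≤n+m 5 (9 * p)))

  -- As long as m < q, the factor 1 + 4m/5q grows at least by β/α when m increases by 1.
  growth : ∀ m → m ≤ q → 5 * q * β ^ᴺ m ≤ α ^ᴺ m * (5 * q + 4 * m)
  growth zero    _   = ≤-reflexive (eq q)
    where
    eq : ∀ q → 5 * q * 1 ≡ 1 * (5 * q + 4 * 0)
    eq = solve-∀
  growth (suc m) m<q = begin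
    5 * q * (β * β ^ᴺ m)                ≡⟨ left-comm (5 * q) β (β ^ᴺ m) ⟩
    β * (5 * q * β ^ᴺ m)                ≤⟨ *-monoʳ-≤ β (growth m (<⇒≤ m<q)) ⟩
    β * (α ^ᴺ m * (5 * q + 4 * m))      ≡⟨ left-comm β (α ^ᴺ m) (5 * q + 4 * m) ⟩
    α ^ᴺ m * (β * (5 * q + 4 * m))      ≤⟨ *-monoʳ-≤ (α ^ᴺ m) step ⟩
    α ^ᴺ m * (α * (5 * q + 4 * suc m))  ≡⟨ trans (left-comm (α ^ᴺ m) α _) (sym (*-assoc α _ _)) ⟩
    α * α ^ᴺ m * (5 * q + 4 * suc m)    ∎
    where
    open ≤-Reasoning
    left-comm : ∀ a b c → a * (b * c) ≡ b * (a * c)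
    left-comm = solve-∀
    step : β * (5 * q + 4 * m) ≤ α * (5 * q + 4 * suc m)
    step with m≤n⇒∃[o]m+o≡n (≤-pred m<q)
    -- The slack is 4α - 4(5q + 4m) = 16(p - m), and m ≤ p.
    ... | d , m+d≡p = subst (λ p → 9 * suc p * (5 * suc p + 4 * m) ≤ (9 * p + 5) * (5 * suc p + 4 * suc m))
      m+d≡p (≤-by (16 * d) (eq m d))
      where
      eq : ∀ m d → 9 * suc (m + d) * (5 * suc (m + d) + 4 * m) + 16 * d
         ≡ (9 * (m + d) + 5) * (5 * suc (m + d) + 4 * suc m)
      eq = solve-∀

  -- The weight (α/β)^r with its denominator cleared. `gone` lists Waiter's elements; if Client has
  -- claimed none of the elements of `y`, its hits in `free` and `gone` have a constant sum, and the
  -- weight is multiplied by that power of β.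
  val : List X → List X → Y → ℕ
  val free gone y = α ^ᴺ hits (hit y) free * β ^ᴺ hits (hit y) gone

  val>0 : ∀ free gone y → 0 < val free gone y
  val>0 free gone y = *-mono-≤ (m^n>0 α (hits (hit y) free)) (m^n>0 β (hits (hit y) gone))

  pot : List X → List X → List Y → ℕ
  pot free gone = ∑ (val free gone)

  deg : List X → List X → List Y → X → ℕ
  deg free gone fam c = ∑ (λ y → 𝟙 (hit y c) * val free gone y) fam

  survivors : X → List Y → List Y
  survivors c = filterᵇ (λ y → not (hit y c))

  hits-++ : ∀ y xs ys → hits (hit y) (xs ++ ys) ≡ hits (hit y) xs + hits (hit y) ys
  hits-++ y = ∑-++ _

  module _ {free Q rest : List X} (free↭ : free ↭ Q ++ rest) {c : X} {Q′ : List X} (Q↭ : Q ↭ c ∷ Q′) (gone : List X) where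

    hits-free : ∀ y → hits (hit y) free ≡ 𝟙 (hit y c) + hits (hit y) Q′ + hits (hit y) rest
    hits-free y = trans (∑-↭ _ free↭) (trans (hits-++ y Q rest)
      (cong (_+ hits (hit y) rest) (∑-↭ _ Q↭)))

    -- If `c` hits `y`, then `y` drops out and its weight is lost. Otherwise the m hits in `Q′` pass
    -- to Waiter, which multiplies the weight by (β/α)^m ≤ 1 + 4m/5q. Everything is scaled by 5q.
    val-step : length Q′ ≡ q → ∀ y →
      5 * q * (𝟙 (not (hit y c)) * val rest (Q′ ++ gone) y) + 5 * q * (𝟙 (hit y c) * val free gone y)
        ≤ 5 * q * val free gone y + 4 * ∑ (λ x → 𝟙 (hit y x) * val free gone y) Q′
    val-step |Q′| y with hits-free y
    ... | eq with hit y c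
    ... | true = begin
      5 * q * 0 + 5 * q * (1 * v)   ≡⟨ eq₁ (5 * q) v ⟩
      5 * q * v                     ≤⟨ m≤m+n _ _ ⟩
      5 * q * v + _                 ∎
      where
      open ≤-Reasoning
      v = val free gone y
      eq₁ : ∀ a v → a * 0 + a * (1 * v) ≡ a * v
      eq₁ = solve-∀
    ... | false = begin
      5 * q * (1 * val rest (Q′ ++ gone) y) + 5 * q * 0
        ≡⟨ cong (λ e → 5 * q * (1 * (α ^ᴺ r * e)) + 5 * q * 0)
             (trans (cong (β ^ᴺ_) (hits-++ y Q′ gone)) (^-distribˡ-+-* β m g)) ⟩
      5 * q * (1 * (α ^ᴺ r * (β ^ᴺ m * β ^ᴺ g))) + 5 * q * 0
        ≡⟨ eq₁ (5 * q) (α ^ᴺ r) (β ^ᴺ m) (β ^ᴺ g) ⟩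
      5 * q * β ^ᴺ m * (α ^ᴺ r * β ^ᴺ g)
        ≤⟨ *-monoˡ-≤ (α ^ᴺ r * β ^ᴺ g) (growth m (subst (m ≤_) |Q′| (hits-≤ (hit y) Q′))) ⟩
      α ^ᴺ m * (5 * q + 4 * m) * (α ^ᴺ r * β ^ᴺ g)
        ≡⟨ eq₂ (5 * q) (α ^ᴺ r) (α ^ᴺ m) (β ^ᴺ g) m ⟩
      5 * q * (α ^ᴺ m * α ^ᴺ r * β ^ᴺ g) + 4 * ((α ^ᴺ m * α ^ᴺ r * β ^ᴺ g) * m)
        ≡⟨ cong (λ v → 5 * q * v + 4 * (v * m)) (sym v≡) ⟩
      5 * q * v + 4 * (v * m)
        ≡⟨ cong (λ s → 5 * q * v + 4 * s) (trans (sym (∑-* v _ Q′)) (∑-cong (λ x → *-comm v (𝟙 (hit y x))) Q′)) ⟩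
      5 * q * v + 4 * ∑ (λ x → 𝟙 (hit y x) * v) Q′ ∎
      where
      open ≤-Reasoning
      m = hits (hit y) Q′
      r = hits (hit y) rest
      g = hits (hit y) gone
      v = val free gone y
      v≡ : v ≡ α ^ᴺ m * α ^ᴺ r * β ^ᴺ g
      v≡ = cong (_* β ^ᴺ g) (trans (cong (α ^ᴺ_) eq) (^-distribˡ-+-* α m r))
      eq₁ : ∀ a b c d → a * (1 * (b * (c * d))) + a * 0 ≡ a * c * (b * d)
      eq₁ = solve-∀
      eq₂ : ∀ a b c d m → c * (a + 4 * m) * (b * d) ≡ a * (c * b * d) + 4 * ((c * b * d) * m)
      eq₂ = solve-∀

    -- Claiming `c` removes the weight `deg c`. The q elements given to Waiter add at most 4/5q
    -- times the sum of their degrees, which is at most `deg c` by the ratio 5/4.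
    pot-step : length Q′ ≡ q → ∀ fam →
      (∀ {x} → x ∈ Q′ → 4 * deg free gone fam x ≤ 5 * deg free gone fam c) →
      pot rest (Q′ ++ gone) (survivors c fam) ≤ pot free gone fam
    pot-step |Q′| fam ratio = *-cancelˡ-≤ (5 * q) (+-cancelʳ-≤ (5 * q * deg free gone fam c) _ _ (begin
      5 * q * pot rest (Q′ ++ gone) (survivors c fam) + 5 * q * deg free gone fam c
        ≡⟨ cong₂ _+_ (trans (cong (5 * q *_) (∑-filterᵇ _ _ fam)) (sym (∑-* (5 * q) _ fam)))
                     (sym (∑-* (5 * q) _ fam)) ⟩
      ∑ _ fam + ∑ _ fam
        ≡⟨ ∑-+ _ _ fam ⟨
      ∑ (λ y → 5 * q * (𝟙 (not (hit y c)) * val rest (Q′ ++ gone) y)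
             + 5 * q * (𝟙 (hit y c) * val free gone y)) fam
        ≤⟨ ∑-mono fam (λ {y} _ → val-step |Q′| y) ⟩
      ∑ (λ y → 5 * q * val free gone y + 4 * ∑ (λ x → 𝟙 (hit y x) * val free gone y) Q′) fam
        ≡⟨ trans (∑-+ _ _ fam) (cong₂ _+_ (∑-* (5 * q) _ fam) (∑-* 4 _ fam)) ⟩
      5 * q * pot free gone fam + 4 * ∑ (λ y → ∑ (λ x → 𝟙 (hit y x) * val free gone y) Q′) fam
        ≡⟨ cong (λ s → 5 * q * pot free gone fam + s)
             (trans (cong (4 *_) (∑-swap _ fam Q′)) (sym (∑-* 4 _ Q′))) ⟩
      5 * q * pot free gone fam + ∑ (λ x → 4 * deg free gone fam x) Q′
        ≤⟨ +-monoʳ-≤ _ (∑-bound _ (5 * deg free gone fam c) Q′ ratio) ⟩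
      5 * q * pot free gone fam + length Q′ * (5 * deg free gone fam c)
        ≡⟨ cong (λ l → 5 * q * pot free gone fam + l * (5 * deg free gone fam c)) |Q′| ⟩
      5 * q * pot free gone fam + q * (5 * deg free gone fam c)
        ≡⟨ cong (5 * q * pot free gone fam +_) (eq q (deg free gone fam c)) ⟩
      5 * q * pot free gone fam + 5 * q * deg free gone fam c ∎))
      where
      open ≤-Reasoning
      eq : ∀ q d → q * (5 * d) ≡ 5 * q * d
      eq = solve-∀

  module _ (E : ℕ) where

    -- `E` counts the elements of `y` beyond 5q, so α^(5q) β^E is the weight of a `y` with exactly
    -- 5q free elements.
    Balanced : List X → List X → Y → Set
    Balanced free gone y = hits (hit y) free + hits (hit y) gone ≡ 5 * q + E

    -- Having at most 5q free hits would mean that some factors α of α^(5q) β^E are replaced by β ≥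
    -- α, so the weight would not be smaller.
    many-hits : ∀ free gone y → Balanced free gone y →
                val free gone y < α ^ᴺ (5 * q) * β ^ᴺ E → 5 * q < hits (hit y) free
    many-hits free gone y bal v< with 5 * q <? hits (hit y) free
    ... | yes 5q< = 5q<
    ... | no  5q≮ = ⊥-elim (<-irrefl refl (<-≤-trans v< (begin
      α ^ᴺ (5 * q) * β ^ᴺ E             ≡⟨ cong (λ e → α ^ᴺ e * β ^ᴺ E) (sym r+d) ⟩
      α ^ᴺ (r + d) * β ^ᴺ E             ≡⟨ cong (_* β ^ᴺ E) (^-distribˡ-+-* α r d) ⟩
      α ^ᴺ r * α ^ᴺ d * β ^ᴺ E          ≤⟨ *-monoˡ-≤ (β ^ᴺ E) (*-monoʳ-≤ (α ^ᴺ r) (^-monoˡ-≤ d α≤β)) ⟩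
      α ^ᴺ r * β ^ᴺ d * β ^ᴺ E          ≡⟨ trans (*-assoc (α ^ᴺ r) _ _) (cong (α ^ᴺ r *_) (sym (^-distribˡ-+-* β d E))) ⟩
      α ^ᴺ r * β ^ᴺ (d + E)             ≡⟨ cong (λ e → α ^ᴺ r * β ^ᴺ e) g≡ ⟨
      α ^ᴺ r * β ^ᴺ g                   ∎)))
      where
      open ≤-Reasoning
      r = hits (hit y) free
      g = hits (hit y) gone
      d = 5 * q ∸ r
      r+d : r + d ≡ 5 * q
      r+d = m+[n∸m]≡n (≮⇒≥ 5q≮)
      g≡ : g ≡ d + E
      g≡ = +-cancelˡ-≡ r g (d + E) (trans bal (trans (cong (_+ E) (sym r+d)) (+-assoc r d E)))
      α≤β : α ≤ β
      α≤β = ≤-by 4 (sym β≡α+4)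

    -- Double counting: the degrees of the free elements add up to the weights times the numbers of
    -- free hits, hence to at least (5q + 1) times the potential. Without a block the sum would be
    -- at most 5q times it; the potential is positive because of `y`.
    find-block : ∀ free gone y fam → (∀ {z} → z ∈ y ∷ fam → Balanced free gone z) →
                 pot free gone (y ∷ fam) < α ^ᴺ (5 * q) * β ^ᴺ E →
                 Block q (deg free gone (y ∷ fam)) free
    find-block free gone y fam bal small
      with block q (deg free gone (y ∷ fam)) (pot free gone (y ∷ fam)) (pot free gone (y ∷ fam)) free
             ≤-refl (λ {c} _ → ∑-mono (y ∷ fam) λ {z} _ →
               ≤-trans (*-monoˡ-≤ (val free gone z) (𝟙≤1 (hit z c))) (≤-reflexive (*-identityˡ _)))
    ... | inj₁ found = found
    ... | inj₂ deg≤ = ⊥-elim (<-irrefl refl (begin-strict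
      5 * (q * pot free gone (y ∷ fam))
        ≡⟨ *-assoc 5 q _ ⟨
      5 * q * pot free gone (y ∷ fam)
        <⟨ m<n+m _ (<-≤-trans (val>0 free gone y) (m≤m+n _ _)) ⟩
      suc (5 * q) * pot free gone (y ∷ fam)
        ≡⟨ ∑-* (suc (5 * q)) (val free gone) (y ∷ fam) ⟨
      ∑ (λ z → suc (5 * q) * val free gone z) (y ∷ fam)
        ≤⟨ ∑-mono (y ∷ fam) (λ {z} z∈ → *-monoˡ-≤ (val free gone z)
             (many-hits free gone z (bal z∈) (≤-<-trans (∈-≤∑ _ z∈) small))) ⟩
      ∑ (λ z → hits (hit z) free * val free gone z) (y ∷ fam)
        ≡⟨ ∑-cong (λ z → trans (*-comm (hits (hit z) free) _) (trans (sym (∑-* (val free gone z) _ free))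
             (∑-cong (λ x → *-comm (val free gone z) (𝟙 (hit z x))) free))) (y ∷ fam) ⟩
      ∑ (λ z → ∑ (λ x → 𝟙 (hit z x) * val free gone z) free) (y ∷ fam)
        ≡⟨ ∑-swap _ (y ∷ fam) free ⟩
      ∑ (deg free gone (y ∷ fam)) free
        ≤⟨ deg≤ ⟩
      5 * (q * pot free gone (y ∷ fam)) ∎))
      where open ≤-Reasoning

    Hit : List X → Y → Set
    Hit S y = Any (λ x → hit y x ≡ true) S

    survivors-hit : ∀ c S fam → All (Hit S) (survivors c fam) → All (Hit (c ∷ S)) fam
    survivors-hit c S []        _    = []
    survivors-hit c S (y ∷ fam) hits with hit y c in eq
    ... | true  = here eq ∷ survivors-hit c S fam hits
    survivors-hit c S (y ∷ fam) (h ∷ hits) | false = there h ∷ survivors-hit c S fam hits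

    ∈-survivors : ∀ c fam {y} → y ∈ survivors c fam → y ∈ fam × hit y c ≡ false
    ∈-survivors c (z ∷ fam) y∈ with hit z c in eq
    ∈-survivors c (z ∷ fam) (here refl) | false = here refl , eq
    ∈-survivors c (z ∷ fam) (there y∈)  | false with ∈-survivors c fam y∈
    ... | y∈′ , h = there y∈′ , h
    ∈-survivors c (z ∷ fam) y∈          | true with ∈-survivors c fam y∈
    ... | y∈′ , h = there y∈′ , h

    -- The potential stays below the weight of a single `y` with 5q free elements. As long as some
    -- `y` is unhit this yields a further offer, so play cannot end before all are hit.
    force : ∀ fuel free gone fam → length free ≤ fuel →
            (∀ {y} → y ∈ fam → Balanced free gone y) →
            pot free gone fam < α ^ᴺ (5 * q) * β ^ᴺ E →
            ∃ λ (σ : WaiterStrategy q free) → ∀ S → FinalClaim q σ S → All (Hit S) fam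
    force-block : ∀ fuel free gone fam → length free ≤ fuel →
            (∀ {y} → y ∈ fam → Balanced free gone y) →
            pot free gone fam < α ^ᴺ (5 * q) * β ^ᴺ E →
            Block q (deg free gone fam) free →
            ∃ λ (σ : WaiterStrategy q free) → ∀ S → FinalClaim q σ S → All (Hit S) fam

    -- Nothing is left to hit: any q + 1 elements can be offered, as all degrees are 0.
    force fuel free gone [] |free| bal small with length free ≤? q
    ... | yes few = WaiterClient.stop few , λ S _ → []
    ... | no many = force-block fuel free gone [] |free| bal small
      (take q′ free , drop q′ free , ↭-reflexive (sym (take++drop≡id q′ free)) ,
       trans (length-take q′ free) (m≤n⇒m⊓n≡m (≰⇒> many)) , λ _ _ → z≤n)
      where q′ = suc q
    force fuel free gone (y ∷ fam) |free| bal small =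
      force-block fuel free gone (y ∷ fam) |free| bal small (find-block free gone y fam bal small)

    force-block zero (x ∷ free) gone fam () bal small blk
    force-block zero [] gone fam z≤n bal small (Q , rest , free↭ , |Q| , _)
      with Q | |Q| | ↭-length free↭
    ... | _ ∷ _ | _ | ()
    force-block (suc fuel) free gone fam |free| bal small (Q , rest , free↭ , |Q| , ratio) =
      WaiterClient.offer o (λ x∈ → proj₁ (next x∈)) , wins
      where
      o : WaiterClient.Offer q free
      o = record { offered = Q ; rest = rest ; split = free↭ ; size = |Q| }
      |rest| : length rest ≤ fuel
      |rest| = ≤-pred (≤-trans (s≤s (m≤n+m (length rest) q))
        (subst (_≤ suc fuel) (trans (↭-length free↭)
          (trans (length-++ Q) (cong (_+ length rest) |Q|))) |free|))
      next : ∀ {x} → x ∈ Q → ∃ λ (σ : WaiterStrategy q rest) →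
             ∀ S → FinalClaim q σ S → All (Hit S) (survivors x fam)
      next {x} x∈ with ∈-↭-∷ x∈
      ... | Q′ , Q↭ = force fuel rest (Q′ ++ gone) (survivors x fam) |rest| bal′
        (≤-<-trans (pot-step free↭ Q↭ gone (suc-injective (trans (sym (↭-length Q↭)) |Q|)) fam
          (λ z∈ → ratio (∈-resp-↭ (↭-sym Q↭) (there z∈)) x∈)) small)
        where
        bal′ : ∀ {y} → y ∈ survivors x fam → Balanced rest (Q′ ++ gone) y
        bal′ {y} y∈ with ∈-survivors x fam y∈
        -- Since Client's element misses `y`, all hits of `y` in the offer move to `gone`.
        ... | y∈fam , missed = trans (cong (hits (hit y) rest +_) (hits-++ y Q′ gone))
          (trans (eq (hits (hit y) rest) (hits (hit y) Q′) (hits (hit y) gone))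
          (trans (cong (_+ hits (hit y) gone) (sym (trans (hits-free free↭ Q↭ gone y)
            (cong (λ b → 𝟙 b + hits (hit y) Q′ + hits (hit y) rest) missed)))) (bal y∈fam)))
          where
          eq : ∀ a b c → a + (b + c) ≡ b + a + c
          eq = solve-∀
      wins : ∀ S → FinalClaim q (WaiterClient.offer o (λ x∈ → proj₁ (next x∈))) S → All (Hit S) fam
      wins _ (WaiterClient.round {x = x} {S = S} x∈ final) =
        survivors-hit x S fam (proj₂ (next x∈) S final)

-- Clauses falsified by an assignment

∑-filter : ∀ {X : Set} {P : X → Set} (f : X → ℕ) (P? : Decidable P) xs →
           ∑ f (filter P? xs) ≡ ∑ (λ x → 𝟙 (does (P? x)) * f x) xs
∑-filter f P? []       = refl
∑-filter f P? (x ∷ xs) with does (P? x)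
... | true  = cong₂ _+_ (sym (+-identityʳ (f x))) (∑-filter f P? xs)
... | false = ∑-filter f P? xs

∑-clauses : ∀ n (f : Clause (suc n) → ℕ) → ∑ f (clauses (suc n)) ≡
  ∑ (f ∘ (nothing ∷_)) (clauses n) +
  (∑ (f ∘ (just false ∷_)) (clauses n) + ∑ (f ∘ (just true ∷_)) (clauses n))
∑-clauses n f = begin
  ∑ f (N ++ (F ++ (P ++ [])))        ≡⟨ trans (∑-++ f N _) (cong (∑ f N +_) (trans (∑-++ f F _)
                                          (cong (∑ f F +_) (trans (∑-++ f P []) (+-identityʳ _))))) ⟩
  ∑ f N + (∑ f F + ∑ f P)            ≡⟨ cong₂ _+_ (∑-map f _ (clauses n))
                                          (cong₂ _+_ (∑-map f _ (clauses n)) (∑-map f _ (clauses n))) ⟩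
  _ ∎
  where
  open ≡-Reasoning
  N = map (nothing ∷_) (clauses n)
  F = map (just false ∷_) (clauses n)
  P = map (just true ∷_) (clauses n)

∑-kClauses : ∀ k n (f : Clause n → ℕ) →
             ∑ f (kClauses k n) ≡ ∑ (λ c → 𝟙 (does (width c ≟ k)) * f c) (clauses n)
∑-kClauses k n f = ∑-filter f (λ c → width c ≟ k) (clauses n)

-- The first variable is absent, negated or plain; this recursion turns the clause counts below into
-- Pascal's rule.
∑-kClauses-suc : ∀ k n (f : Clause (suc n) → ℕ) → ∑ f (kClauses (suc k) (suc n)) ≡
  ∑ (f ∘ (nothing ∷_)) (kClauses (suc k) n) +
  (∑ (f ∘ (just false ∷_)) (kClauses k n) + ∑ (f ∘ (just true ∷_)) (kClauses k n))
∑-kClauses-suc k n f = trans (∑-kClauses (suc k) (suc n) f) (trans (∑-clauses n _)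
  (sym (cong₂ _+_ (∑-kClauses (suc k) n _) (cong₂ _+_ (∑-kClauses k n _) (∑-kClauses k n _)))))

∑-kClauses-zero : ∀ n (f : Clause (suc n) → ℕ) →
                  ∑ f (kClauses 0 (suc n)) ≡ ∑ (f ∘ (nothing ∷_)) (kClauses 0 n)
∑-kClauses-zero n f = trans (∑-kClauses 0 (suc n) f) (trans (∑-clauses n _)
  (trans (cong₂ _+_ (sym (∑-kClauses 0 n _)) (cong₂ _+_ (∑-zero (clauses n)) (∑-zero (clauses n)))) (+-identityʳ _)))

nC0≡1 : ∀ n → n C 0 ≡ 1
nC0≡1 n = trans (nCk≡nC[n∸k] {0} {n} z≤n) (nCn≡1 n)

-- An absent variable yields `true`, so that the conjunction over all variables says that every
-- literal of the clause is false.
falsifiedBy : Bool → Maybe Bool → Bool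
falsifiedBy _ nothing      = true
falsifiedBy t (just false) = t
falsifiedBy t (just true)  = not t

falsified : ∀ {n} → Assignment n → Clause n → Bool
falsified []      []      = true
falsified (t ∷ τ) (x ∷ c) = falsifiedBy t x ∧ falsified τ c

falsified-sound : ∀ {n} (τ : Assignment n) c → falsified τ c ≡ true → ¬ TrueClause τ c
falsified-sound τ c fals ((i , b) , b∈c , τi) = go τ c i fals b∈c τi
  where
  go : ∀ {n} (τ : Assignment n) c i → falsified τ c ≡ true → lookup c i ≡ just b → lookup τ i ≡ b → ⊥
  go (true  ∷ τ) (just false ∷ c) zero    fals () refl
  go (false ∷ τ) (just true  ∷ c) zero    fals () refl
  go (t     ∷ τ) (nothing    ∷ c) (suc i) fals = go τ c i fals
  go (true  ∷ τ) (just false ∷ c) (suc i) fals = go τ c i fals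
  go (false ∷ τ) (just true  ∷ c) (suc i) fals = go τ c i fals

-- Each set of k variables carries exactly one falsified clause: only one sign of each variable is
-- false.
count-falsified : ∀ k {n} (τ : Assignment n) → hits (falsified τ) (kClauses k n) ≡ n C k
count-falsified zero    []      = refl
count-falsified (suc k) []      = sym (k>n⇒nCk≡0 {0} {suc k} (s≤s z≤n))
count-falsified zero    {suc n} (t ∷ τ) =
  trans (∑-kClauses-zero n _) (trans (count-falsified zero τ) (trans (nC0≡1 n) (sym (nC0≡1 (suc n)))))
count-falsified (suc k) {suc n} (t ∷ τ) = begin
  hits (falsified (t ∷ τ)) (kClauses (suc k) (suc n))   ≡⟨ ∑-kClauses-suc k n _ ⟩
  hits (falsified τ) (kClauses (suc k) n) + _           ≡⟨ cong₂ _+_ (count-falsified (suc k) τ) (signs t) ⟩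
  n C suc k + n C k                                     ≡⟨ +-comm (n C suc k) (n C k) ⟩
  n C k + n C suc k                                     ≡⟨ nCk+nC[k+1]≡[n+1]C[k+1] n k ⟩
  suc n C suc k                                         ∎
  where
  open ≡-Reasoning
  signs : ∀ t → hits (falsified (t ∷ τ) ∘ (just false ∷_)) (kClauses k n)
              + hits (falsified (t ∷ τ) ∘ (just true ∷_)) (kClauses k n) ≡ n C k
  signs true  = trans (cong (hits (falsified τ) (kClauses k n) +_) (∑-zero (kClauses k n)))
                  (trans (+-identityʳ _) (count-falsified k τ))
  signs false = trans (cong (_+ hits (falsified τ) (kClauses k n)) (∑-zero (kClauses k n)))
                  (count-falsified k τ)

assignments : ∀ n → List (Assignment n)
assignments zero    = [] ∷ []
assignments (suc n) = map (false ∷_) (assignments n) ++ map (true ∷_) (assignments n)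

∈-assignments : ∀ {n} (τ : Assignment n) → τ ∈ assignments n
∈-assignments []          = here refl
∈-assignments (false ∷ τ) = ∈-++⁺ˡ (∈-map⁺ (false ∷_) (∈-assignments τ))
∈-assignments (true ∷ τ)  = ∈-++⁺ʳ _ (∈-map⁺ (true ∷_) (∈-assignments τ))

length-assignments : ∀ n → length (assignments n) ≡ 2 ^ᴺ n
length-assignments zero    = refl
length-assignments (suc n) = trans (length-++ (map (false ∷_) (assignments n)))
  (cong₂ _+_ (trans (length-map _ (assignments n)) (length-assignments n))
    (trans (trans (length-map _ (assignments n)) (length-assignments n)) (sym (+-identityʳ _))))

-- Decay of the weight against the number of assignments

-- β/α ≥ 1 + 4/9q, so (β/α)^q ≥ 13/9 by Bernoulli's inequality.
module Growth (p : ℕ) where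

  private
    q = suc p
    α = 9 * p + 5
    β = 9 * q

  bernoulli : ∀ m → α ^ᴺ m * (9 * q + 4 * m) ≤ 9 * q * β ^ᴺ m
  bernoulli zero    = ≤-reflexive (eq q)
    where
    eq : ∀ q → 1 * (9 * q + 4 * 0) ≡ 9 * q * 1
    eq = solve-∀
  bernoulli (suc m) = begin
    α * α ^ᴺ m * (9 * q + 4 * suc m)     ≡⟨ eq₁ α (α ^ᴺ m) _ ⟩
    α ^ᴺ m * (α * (9 * q + 4 * suc m))   ≤⟨ *-monoʳ-≤ (α ^ᴺ m) (≤-by (16 * m + 16) (eq₂ p m)) ⟩
    α ^ᴺ m * (β * (9 * q + 4 * m))       ≡⟨ eq₃ (α ^ᴺ m) β _ ⟩
    β * (α ^ᴺ m * (9 * q + 4 * m))       ≤⟨ *-monoʳ-≤ β (bernoulli m) ⟩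
    β * (9 * q * β ^ᴺ m)                 ≡⟨ eq₃ β (9 * q) (β ^ᴺ m) ⟩
    9 * q * (β * β ^ᴺ m)                 ∎
    where
    open ≤-Reasoning
    eq₁ : ∀ a b c → a * b * c ≡ b * (a * c)
    eq₁ = solve-∀
    eq₂ : ∀ p m → (9 * p + 5) * (9 * suc p + 4 * suc m) + (16 * m + 16) ≡ 9 * suc p * (9 * suc p + 4 * m)
    eq₂ = solve-∀
    eq₃ : ∀ a b c → a * (b * c) ≡ b * (a * c)
    eq₃ = solve-∀

  ^q-growth : 13 * α ^ᴺ q ≤ 9 * β ^ᴺ q
  ^q-growth = *-cancelˡ-≤ q (begin
    q * (13 * α ^ᴺ q)             ≡⟨ eq₁ q (α ^ᴺ q) ⟩
    α ^ᴺ q * (9 * q + 4 * q)      ≤⟨ bernoulli q ⟩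
    9 * q * β ^ᴺ q                ≡⟨ eq₂ q (β ^ᴺ q) ⟩
    q * (9 * β ^ᴺ q)              ∎)
    where
    open ≤-Reasoning
    eq₁ : ∀ q a → q * (13 * a) ≡ a * (9 * q + 4 * q)
    eq₁ = solve-∀
    eq₂ : ∀ q b → 9 * q * b ≡ q * (9 * b)
    eq₂ = solve-∀

  A B : ℕ
  A = α ^ᴺ q * α ^ᴺ q
  B = β ^ᴺ q * β ^ᴺ q

  A>0 : 0 < A
  A>0 = *-mono-≤ pos pos
    where
    pos : 0 < α ^ᴺ q
    pos = m^n>0 α {{>-nonZero (≤-trans (s≤s z≤n) (m≤n+m 5 (9 * p)))}} q

  ^2q-growth : 169 * A ≤ 81 * B
  ^2q-growth = begin
    169 * A                           ≡⟨ eq₁ (α ^ᴺ q) ⟩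
    13 * α ^ᴺ q * (13 * α ^ᴺ q)       ≤⟨ *-mono-≤ ^q-growth ^q-growth ⟩
    9 * β ^ᴺ q * (9 * β ^ᴺ q)         ≡⟨ eq₂ (β ^ᴺ q) ⟩
    81 * B                            ∎
    where
    open ≤-Reasoning
    eq₁ : ∀ a → 169 * (a * a) ≡ 13 * a * (13 * a)
    eq₁ = solve-∀
    eq₂ : ∀ b → 9 * b * (9 * b) ≡ 81 * (b * b)
    eq₂ = solve-∀

  -- 169/81 = 2 (1 + 7/162)
  doubling : ∀ N → 2 ^ᴺ N * A ^ᴺ N * (162 + 7 * N) ≤ 162 * B ^ᴺ N
  doubling zero    = ≤-refl
  doubling (suc N) = *-cancelˡ-≤ 162 (begin
    162 * (2 * 2 ^ᴺ N * (A * A ^ᴺ N) * (162 + 7 * suc N))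
      ≡⟨ eq₁ (2 ^ᴺ N) A (A ^ᴺ N) (162 + 7 * suc N) ⟩
    2 ^ᴺ N * A ^ᴺ N * (2 * A) * (162 * (162 + 7 * suc N))
      ≤⟨ *-monoʳ-≤ (2 ^ᴺ N * A ^ᴺ N * (2 * A)) slope ⟩
    2 ^ᴺ N * A ^ᴺ N * (2 * A) * (169 * (162 + 7 * N))
      ≡⟨ eq₃ (2 ^ᴺ N * A ^ᴺ N) A (162 + 7 * N) ⟩
    2 * (169 * A) * (2 ^ᴺ N * A ^ᴺ N * (162 + 7 * N))
      ≤⟨ *-mono-≤ (*-monoʳ-≤ 2 ^2q-growth) (doubling N) ⟩
    2 * (81 * B) * (162 * B ^ᴺ N)
      ≡⟨ eq₄ B (B ^ᴺ N) ⟩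
    162 * (162 * (B * B ^ᴺ N)) ∎)
    where
    open ≤-Reasoning
    eq₁ : ∀ t a s w → 162 * (2 * t * (a * s) * w) ≡ t * s * (2 * a) * (162 * w)
    eq₁ = solve-∀
    eq₂ : ∀ N → 162 * (162 + 7 * suc N) + 49 * N ≡ 169 * (162 + 7 * N)
    eq₂ = solve-∀
    slope : 162 * (162 + 7 * suc N) ≤ 169 * (162 + 7 * N)
    slope = ≤-by (49 * N) (eq₂ N)
    eq₃ : ∀ x a w → x * (2 * a) * (169 * w) ≡ 2 * (169 * a) * (x * w)
    eq₃ = solve-∀
    eq₄ : ∀ b s → 2 * (81 * b) * (162 * s) ≡ 162 * (162 * (b * s))
    eq₄ = solve-∀

  -- Exponents beyond 2qN do no harm, since α ≤ β. The extra factor 8 is absorbed by the linear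
  -- factor in `doubling`: 162 + 7 · 163 = 1303 exceeds 8 · 162 = 1296.
  exponential-gap : ∀ N → 163 ≤ N → ∀ E → 2 * q * N ≤ E → 2 ^ᴺ (3 + N) * α ^ᴺ E < β ^ᴺ E
  exponential-gap N 163≤N E 2qN≤E with m≤n⇒∃[o]m+o≡n 2qN≤E
  ... | d , refl = begin-strict
    2 ^ᴺ (3 + N) * α ^ᴺ (2 * q * N + d)     ≡⟨ cong (2 ^ᴺ (3 + N) *_) (split α) ⟩
    2 ^ᴺ (3 + N) * (A ^ᴺ N * α ^ᴺ d)        ≡⟨ *-assoc (2 ^ᴺ (3 + N)) _ _ ⟨
    2 ^ᴺ (3 + N) * A ^ᴺ N * α ^ᴺ d          ≤⟨ *-monoʳ-≤ (2 ^ᴺ (3 + N) * A ^ᴺ N) (^-monoˡ-≤ d α≤β) ⟩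
    2 ^ᴺ (3 + N) * A ^ᴺ N * β ^ᴺ d          <⟨ *-monoˡ-< (β ^ᴺ d) {{m^n≢0 β d}} core ⟩
    B ^ᴺ N * β ^ᴺ d                         ≡⟨ split β ⟨
    β ^ᴺ (2 * q * N + d)                    ∎
    where
    open ≤-Reasoning
    α≤β : α ≤ β
    α≤β = ≤-by 4 (eq p)
      where
      eq : ∀ p → 9 * p + 5 + 4 ≡ 9 * suc p
      eq = solve-∀
    split : ∀ x → x ^ᴺ (2 * q * N + d) ≡ (x ^ᴺ q * x ^ᴺ q) ^ᴺ N * x ^ᴺ d
    split x = trans (^-distribˡ-+-* x (2 * q * N) d) (cong (_* x ^ᴺ d)
      (trans (sym (^-*-assoc x (2 * q) N)) (cong (_^ᴺ N)
        (trans (cong (x ^ᴺ_) (cong (q +_) (+-identityʳ q))) (^-distribˡ-+-* x q q)))))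
    core : 2 ^ᴺ (3 + N) * A ^ᴺ N < B ^ᴺ N
    core = *-cancelˡ-< 162 _ _ (begin-strict
      162 * (2 ^ᴺ (3 + N) * A ^ᴺ N)            ≡⟨ eq (2 ^ᴺ N) (A ^ᴺ N) ⟩
      2 ^ᴺ N * A ^ᴺ N * 1296                   <⟨ *-monoʳ-< (2 ^ᴺ N * A ^ᴺ N) {{pos}} {1296} {162 + 7 * N}
                                                    (<-≤-trans (≤ᵇ⇒≤ 1297 (162 + 7 * 163) _) (+-monoʳ-≤ 162 (*-monoʳ-≤ 7 163≤N))) ⟩
      2 ^ᴺ N * A ^ᴺ N * (162 + 7 * N)          ≤⟨ doubling N ⟩
      162 * B ^ᴺ N                             ∎)
      where
      pos : NonZero (2 ^ᴺ N * A ^ᴺ N)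
      pos = m*n≢0 _ _ {{m^n≢0 2 N}} {{m^n≢0 A N {{>-nonZero A>0}}}}
      eq : ∀ t a → 162 * (2 * (2 * (2 * t)) * a) ≡ t * a * 1296
      eq = solve-∀

-- The sets to be met are, for each assignment, the C(n,k) clauses falsified by it. Once Client has
-- a clause from each, no assignment satisfies his formula.
waiter-wins : ∀ k n q → 1 ≤ q → 166 ≤ n → 2 * n * q ≤ n C k →
  ∃ λ (σ : WaiterStrategy q (kClauses k n)) → ∀ S → FinalClaim q σ S → ¬ Satisfiable S
waiter-wins k n (suc p) _ 166≤n 2nq≤C with m≤n⇒∃[o]m+o≡n (≤-trans (m≤m+n 3 163) 166≤n)
-- In 2nq = 6q + 2Nq the term 6q pays for the 5q elements set aside, which leaves `E` ≥ 2qN.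
... | N , refl = proj₁ forced , λ S final (τ , true-clauses) →
  contradict S τ true-clauses (All.lookup (proj₂ forced S final) (∈-assignments τ))
  where
  q = suc p
  open Transversal (falsified {3 + N}) p using (α; β; pot; Balanced; Hit; force)
  E = (3 + N) C k ∸ 5 * q
  6q≤ : 6 * q ≤ 2 * (3 + N) * q
  6q≤ = *-monoˡ-≤ q (*-monoʳ-≤ 2 (m≤m+n 3 N))
  C≡ : 5 * q + E ≡ (3 + N) C k
  C≡ = m+[n∸m]≡n (≤-trans (*-monoˡ-≤ q (m≤m+n 5 1)) (≤-trans 6q≤ 2nq≤C))
  E≥ : 2 * q * N ≤ E
  E≥ = +-cancelˡ-≤ (5 * q) _ _ (≤-trans (≤-by q (eq q N)) (≤-trans 2nq≤C (≤-reflexive (sym C≡))))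
    where
    eq : ∀ q N → 5 * q + 2 * q * N + q ≡ 2 * (3 + N) * q
    eq = solve-∀
  board = kClauses k (3 + N)
  small : pot board [] (assignments (3 + N)) < α ^ᴺ (5 * q) * β ^ᴺ E
  small = begin-strict
    ∑ (λ τ → α ^ᴺ hits (falsified τ) board * 1) (assignments (3 + N))
      ≡⟨ ∑-cong (λ τ → trans (*-identityʳ _) (cong (α ^ᴺ_) (trans (count-falsified k τ) (sym C≡)))) (assignments (3 + N)) ⟩
    ∑ (λ τ → α ^ᴺ (5 * q + E)) (assignments (3 + N))
      ≡⟨ trans (∑-const _ (assignments (3 + N))) (cong₂ _*_ (length-assignments (3 + N)) (^-distribˡ-+-* α (5 * q) E)) ⟩
    2 ^ᴺ (3 + N) * (α ^ᴺ (5 * q) * α ^ᴺ E)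
      ≡⟨ eq (2 ^ᴺ (3 + N)) (α ^ᴺ (5 * q)) (α ^ᴺ E) ⟩
    α ^ᴺ (5 * q) * (2 ^ᴺ (3 + N) * α ^ᴺ E)
      <⟨ *-monoʳ-< (α ^ᴺ (5 * q)) {{m^n≢0 α (5 * q) {{Transversal.α≢0 (falsified {3 + N}) p}}}}
           (Growth.exponential-gap p N (+-cancelˡ-≤ 3 _ _ 166≤n) E E≥) ⟩
    α ^ᴺ (5 * q) * β ^ᴺ E ∎
    where
    open ≤-Reasoning
    eq : ∀ a b c → a * (b * c) ≡ b * (a * c)
    eq = solve-∀
  forced : ∃ λ (σ : WaiterStrategy q board) → ∀ S → FinalClaim q σ S → All (Hit E S) (assignments (3 + N))
  forced = force E (length board) board [] (assignments (3 + N)) ≤-refl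
    (λ {τ} _ → trans (+-identityʳ _) (trans (count-falsified k τ) (sym C≡))) small
  contradict : ∀ S τ → All (TrueClause τ) S → Hit E S τ → ⊥
  contradict (c ∷ S) τ (tc ∷ _)  (here fals) = falsified-sound τ c fals tc
  contradict (c ∷ S) τ (_ ∷ tcs) (there h)   = contradict S τ tcs h

-- Client avoids every set of a family

module Avoidance (hit : Y → X → Bool) (q : ℕ) where

  -- The expected weight of y when Client claims a uniformly random offered element: y dies as
  -- soon as Waiter gets an element of it.
  reweigh : List X → X → (Y → ℕ) → Y → ℕ
  reweigh Q x κ y = κ y * (𝟙 (hits (hit y) Q ≤ᵇ 𝟙 (hit y x)) * suc q ^ᴺ 𝟙 (hit y x))

  -- The average factor is at most 1. With no hit in `Q` there are q + 1 factors 1; with one hit a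
  -- single factor q + 1 survives; with two or more, Waiter always gets an element of `y`.
  factors : ∀ y Q → length Q ≡ suc q →
            ∑ (λ x → 𝟙 (hits (hit y) Q ≤ᵇ 𝟙 (hit y x)) * suc q ^ᴺ 𝟙 (hit y x)) Q ≤ suc q
  factors y Q |Q| = go (hits (hit y) Q) refl
    where
    factor : ℕ → Bool → ℕ
    factor m b = 𝟙 (m ≤ᵇ 𝟙 b) * suc q ^ᴺ 𝟙 b
    go : ∀ m → hits (hit y) Q ≡ m → ∑ (factor m ∘ hit y) Q ≤ suc q
    go zero m≡ = ≤-trans (∑-bound _ 1 Q unhit) (≤-reflexive (trans (*-identityʳ _) |Q|))
      where
      unhit : ∀ {x} → x ∈ Q → factor 0 (hit y x) ≤ 1
      unhit {x} x∈ with hit y x in hx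
      ... | false = ≤-refl
      ... | true  = ⊥-elim (<-irrefl refl (subst₂ _≤_ (cong 𝟙 hx) m≡ (∈-≤∑ (𝟙 ∘ hit y) x∈)))
    go (suc zero) m≡ = ≤-trans (∑-mono Q λ {x} _ → only-hit (hit y x))
      (≤-reflexive (trans (∑-* (suc q) _ Q) (trans (cong (suc q *_) m≡) (*-identityʳ (suc q)))))
      where
      only-hit : ∀ b → factor 1 b ≤ suc q * 𝟙 b
      only-hit true  = ≤-reflexive (trans (+-identityʳ _) (trans (*-identityʳ (suc q)) (sym (*-identityʳ (suc q)))))
      only-hit false = z≤n
    go (suc (suc m)) m≡ = ≤-trans (∑-mono Q λ {x} _ → dead (hit y x)) (≤-trans (≤-reflexive (∑-zero Q)) z≤n)
      where
      dead : ∀ b → factor (2 + m) b ≤ 0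
      dead true  = z≤n
      dead false = z≤n

  -- Averaged over the offer, the new total weight does not exceed the old one, so some choice does
  -- no worse than the average.
  good-choice : ∀ fam κ Q → length Q ≡ suc q →
                ∃ λ x → x ∈ Q × ∑ (reweigh Q x κ) fam ≤ ∑ κ fam
  good-choice fam κ []       ()
  good-choice fam κ (x ∷ xs) |Q| = average (λ z → ∑ (reweigh Q z κ) fam) (∑ κ fam) x xs (begin
    ∑ (λ z → ∑ (reweigh Q z κ) fam) Q                ≡⟨ ∑-swap (λ z → reweigh Q z κ) Q fam ⟩
    ∑ (λ y → ∑ (λ z → reweigh Q z κ y) Q) fam        ≡⟨ ∑-cong (λ y → ∑-* (κ y) _ Q) fam ⟩
    ∑ (λ y → κ y * ∑ (λ z → 𝟙 (hits (hit y) Q ≤ᵇ 𝟙 (hit y z)) * suc q ^ᴺ 𝟙 (hit y z)) Q) fam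
      ≤⟨ ∑-mono fam (λ {y} _ → *-monoʳ-≤ (κ y) (factors y Q |Q|)) ⟩
    ∑ (λ y → κ y * suc q) fam                        ≡⟨ ∑-cong (λ y → *-comm (κ y) (suc q)) fam ⟩
    ∑ (λ y → suc q * κ y) fam                        ≡⟨ ∑-* (suc q) κ fam ⟩
    suc q * ∑ κ fam                                  ≡⟨ cong (_* ∑ κ fam) |Q| ⟨
    length Q * ∑ κ fam                               ∎)
    where
    open ≤-Reasoning
    Q = x ∷ xs

  -- The premise `hits (hit y) free ≤ hits (hit y) S` says that Client ends up with every free
  -- element of `y`. Its weight then grew by a factor q + 1 per element and is still within the
  -- initial total.
  Bounded : List Y → List X → (Y → ℕ) → List X → Set
  Bounded fam free κ S = (∀ y → hits (hit y) S ≤ hits (hit y) free) ×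
    (∀ {y} → y ∈ fam → hits (hit y) free ≤ hits (hit y) S →
      κ y * suc q ^ᴺ hits (hit y) S ≤ ∑ κ fam)

  hits-round : ∀ {free} Q rest → free ↭ Q ++ rest → ∀ y →
               hits (hit y) free ≡ hits (hit y) Q + hits (hit y) rest
  hits-round Q rest free↭ y = trans (∑-↭ _ free↭) (∑-++ _ Q rest)

  bounded-round : ∀ fam free Q rest x κ S → free ↭ Q ++ rest → x ∈ Q →
                  ∑ (reweigh Q x κ) fam ≤ ∑ κ fam →
                  Bounded fam rest (reweigh Q x κ) S → Bounded fam free κ (x ∷ S)
  bounded-round fam free Q rest x κ S free↭ x∈ κ≤ (fewer , bound) = fewer′ , bound′
    where
    hx≤ : ∀ y → 𝟙 (hit y x) ≤ hits (hit y) Q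
    hx≤ y = ∈-≤∑ (𝟙 ∘ hit y) x∈
    fewer′ : ∀ y → hits (hit y) (x ∷ S) ≤ hits (hit y) free
    fewer′ y = ≤-trans (+-mono-≤ (hx≤ y) (fewer y)) (≤-reflexive (sym (hits-round Q rest free↭ y)))
    bound′ : ∀ {y} → y ∈ fam → hits (hit y) free ≤ hits (hit y) (x ∷ S) →
             κ y * suc q ^ᴺ hits (hit y) (x ∷ S) ≤ ∑ κ fam
    bound′ {y} y∈ all = ≤-trans (≤-reflexive (sym same)) (≤-trans (bound y∈ rest≤) κ≤)
      where
      h = 𝟙 (hit y x)
      m = hits (hit y) Q
      r = hits (hit y) rest
      s = hits (hit y) S
      all′ : m + r ≤ h + s
      all′ = subst (_≤ h + s) (hits-round Q rest free↭ y) all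
      rest≤ : r ≤ s
      rest≤ = +-cancelˡ-≤ h r s (≤-trans (+-monoˡ-≤ r (hx≤ y)) all′)
      -- `S` can contain at most the r hits of `rest`, so Client's element accounts for every hit in
      -- the offer, and `y` stays alive.
      m≤h : m ≤ h
      m≤h = +-cancelʳ-≤ r m h (≤-trans all′ (+-monoʳ-≤ h (fewer y)))
      alive : 𝟙 (m ≤ᵇ h) ≡ 1
      alive with m ≤ᵇ h | ≤⇒≤ᵇ m≤h
      ... | true | _ = refl
      same : reweigh Q x κ y * suc q ^ᴺ s ≡ κ y * suc q ^ᴺ (h + s)
      same = begin
        κ y * (𝟙 (m ≤ᵇ h) * suc q ^ᴺ h) * suc q ^ᴺ s  ≡⟨ cong (λ a → κ y * (a * suc q ^ᴺ h) * suc q ^ᴺ s) alive ⟩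
        κ y * (1 * suc q ^ᴺ h) * suc q ^ᴺ s           ≡⟨ eq (κ y) (suc q ^ᴺ h) (suc q ^ᴺ s) ⟩
        κ y * (suc q ^ᴺ h * suc q ^ᴺ s)               ≡⟨ cong (κ y *_) (^-distribˡ-+-* (suc q) h s) ⟨
        κ y * suc q ^ᴺ (h + s)                        ∎
        where
        open ≡-Reasoning
        eq : ∀ a b c → a * (1 * b) * c ≡ a * (b * c)
        eq = solve-∀

  avoid : ∀ fam fuel free κ → length free ≤ fuel →
          ∃ λ (τ : ClientStrategy q free) → ∀ S → Claim q τ S → Bounded fam free κ S
  avoid fam fuel free κ |free| = WaiterClient.respond reply , bounded
    where
    open WaiterClient.Offer
    -- The choice, the continuation and its guarantee are produced together, so that `bounded`
    -- speaks of the very continuation that is played.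
    reply′ : ∀ fuel → length free ≤ fuel → (o : WaiterClient.Offer q free) →
            ∃ λ x → x ∈ offered o × ∃ λ (τ : ClientStrategy q (rest o)) →
            ∀ S → Claim q τ S → Bounded fam free κ (x ∷ S)
    reply′ fuel |free| o with good-choice fam κ (offered o) (size o)
    ... | x , x∈ , κ≤ with fuel | subst (_≤ fuel) (trans (↭-length (split o))
      (trans (length-++ (offered o)) (cong (_+ length (rest o)) (size o)))) |free|
    ... | suc fuel | s≤s |o| with avoid fam fuel (rest o) (reweigh (offered o) x κ)
                                    (≤-trans (m≤n+m _ q) |o|)
    ... | τ , bound = x , x∈ , τ , λ S claim →
      bounded-round fam free (offered o) (rest o) x κ S (split o) x∈ κ≤ (bound S claim)
    reply : (o : WaiterClient.Offer q free) → ∃ λ x → x ∈ offered o × ClientStrategy q (rest o)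
    reply o with reply′ fuel |free| o
    ... | x , x∈ , τ , _ = x , x∈ , τ
    bounded : ∀ S → Claim q (WaiterClient.respond reply) S → Bounded fam free κ S
    bounded [] WaiterClient.now = (λ _ → z≤n) ,
      λ y∈ _ → ≤-trans (≤-reflexive (*-identityʳ _)) (∈-≤∑ κ y∈)
    bounded _ (WaiterClient.round {S = S} o claim) = proj₂ (proj₂ (proj₂ (reply′ fuel |free| o))) S claim

claimed-free : ∀ {q} {free : List X} {τ : ClientStrategy q free} {S} →
               Claim q τ S → All (_∈ free) S
claimed-free WaiterClient.now = []
claimed-free (WaiterClient.round {f = f} o claim) =
  ∈-resp-↭ (↭-sym (split o)) (∈-++⁺ˡ (proj₁ (proj₂ (f o)))) ∷
  All.map (λ x∈ → ∈-resp-↭ (↭-sym (split o)) (∈-++⁺ʳ (offered o) x∈)) (claimed-free claim)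
  where open WaiterClient.Offer

-- A formula without cycles is satisfiable

private variable
  n : ℕ

Unique-resp-↭ : ∀ {xs ys : List X} → xs ↭ ys → Unique xs → Unique ys
Unique-resp-↭ {X} p = Permutation.Unique-resp-↭ (setoid X) (↭⇒↭ₛ p)

occurs : Fin n → Clause n → Bool
occurs i c = is-just (lookup c i)

literal : ∀ (c : Clause n) i → occurs i c ≡ true → ∃ λ b → (i , b) ∈ᶜ c
literal c i eq with lookup c i
... | just b = b , refl

some-variable : ∀ (c : Clause n) → 1 ≤ width c → ∃ λ i → occurs i c ≡ true
some-variable (just b  ∷ c) _ = zero , refl
some-variable (nothing ∷ c) w with some-variable c w
... | i , eq = suc i , eq

other-variable : ∀ (c : Clause n) j → 2 ≤ width c → ∃ λ i → i ≢ j × occurs i c ≡ true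
other-variable (just b  ∷ c) zero    (s≤s w) with some-variable c w
... | i , eq = suc i , (λ ()) , eq
other-variable (nothing ∷ c) zero    w with some-variable c (≤-trans (s≤s z≤n) w)
... | i , eq = suc i , (λ ()) , eq
other-variable (just b  ∷ c) (suc j) w = zero , (λ ()) , refl
other-variable (nothing ∷ c) (suc j) w with other-variable c j w
... | i , i≢j , eq = suc i , (λ { refl → i≢j refl }) , eq

-- A walk in the incidence graph of variables and clauses: each clause is entered and left through
-- different variables.
data Walk {n} : Fin n → Fin n → List (Clause n) → Set where
  last : ∀ {y z c} → y ≢ z → occurs y c ≡ true → occurs z c ≡ true → Walk y z (c ∷ [])
  step : ∀ {y x z c A} → y ≢ x → occurs y c ≡ true → occurs x c ≡ true →
         Walk x z A → Walk y z (c ∷ A)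

-- Only the clauses have to be distinct; variables may recur. A single clause is never a cycle, as
-- `last` requires different ends.
Cycle : List (Clause n) → Set
Cycle S = ∃₂ λ z A → Walk z z A × Unique A × All (_∈ S) A

-- Trail x (c ∷ P): a walk along P that has just entered c through the variable x.
data Trail {n} : Fin n → List (Clause n) → Set where
  start  : ∀ {x c} → occurs x c ≡ true → Trail x (c ∷ [])
  extend : ∀ {x x′ c c′ P} → occurs x c ≡ true → occurs x c′ ≡ true → x ≢ x′ →
           Trail x′ (c′ ∷ P) → Trail x (c ∷ c′ ∷ P)

entry : ∀ {x : Fin n} {c P} → Trail x (c ∷ P) → occurs x c ≡ true
entry (start x∈c)        = x∈c
entry (extend x∈c _ _ _) = x∈c

Private : Fin n → List (Clause n) → Set
Private z = All (λ c → occurs z c ≡ false)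

occurs-≢ : ∀ {x z : Fin n} c → occurs x c ≡ true → occurs z c ≡ false → x ≢ z
occurs-≢ c x∈c z∉c refl with trans (sym x∈c) z∉c
... | ()

-- Going back to the latest earlier clause that contains `z`, the part of the trail passed over is a
-- walk from `x` to `z`.
trace-back : ∀ {x : Fin n} {c P} → Trail x (c ∷ P) → ∀ z → x ≢ z →
             (∃₂ λ A B → P ≡ A ++ B × Walk x z A) ⊎ Private z P
trace-back (start _) z x≢z = inj₂ []
trace-back (extend {c′ = c′} {P = P} x∈c x∈c′ x≢x′ trail) z x≢z with occurs z c′ in z∈c′
... | true  = inj₁ ([ c′ ] , P , refl , last x≢z x∈c′ z∈c′)
-- The entry variable of `c′` differs from `z`, because `z` does not occur in `c′`.
... | false with trace-back trail z (occurs-≢ c′ (entry trail) z∈c′)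
...   | inj₁ (A , B , refl , walk) = inj₁ (c′ ∷ A , B , refl , step x≢x′ x∈c′ (entry trail) walk)
...   | inj₂ none                  = inj₂ (z∈c′ ∷ none)

Removable : List (Clause n) → Set
Removable S = ∃₂ λ c Q → S ↭ c ∷ Q × ∃ λ z → occurs z c ≡ true × Private z Q

find-occurrence : ∀ (z : Fin n) R → (∃₂ λ c R′ → R ↭ c ∷ R′ × occurs z c ≡ true) ⊎ Private z R
find-occurrence z [] = inj₂ []
find-occurrence z (c ∷ R) with occurs z c in z∈c
... | true  = inj₁ (c , R , ↭-refl , z∈c)
... | false with find-occurrence z R
...   | inj₂ none = inj₂ (z∈c ∷ none)
...   | inj₁ (c′ , R′ , R↭ , z∈c′) =
  inj₁ (c′ , c ∷ R′ , ↭-trans (prep c R↭) (shift c′ [ c ] R′) , z∈c′)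

Unique-++ˡ : ∀ (xs : List X) {ys} → Unique (xs ++ ys) → Unique xs
Unique-++ˡ []       _          = []
Unique-++ˡ (x ∷ xs) (x∉ ∷ uni) = All.++⁻ˡ xs x∉ ∷ Unique-++ˡ xs uni

-- A clause of width at least 2 can be left through some `z` ≢ `x`. Either `z` occurs earlier on the
-- trail and closes a cycle, or it occurs in `R` and extends the trail, or it is private to `c`. The
-- trail can only grow until `R` is used up.
cycle-or-removable : ∀ fuel {S : List (Clause n)} → Unique S → All (λ c → 2 ≤ width c) S →
  ∀ {x c P} → Trail x (c ∷ P) → ∀ R → S ↭ (c ∷ P) ++ R → length R ≤ fuel → Cycle S ⊎ Removable S
cycle-or-removable fuel uni wide {x} {c} {P} trail R S↭ |R|
  with other-variable c x (All.lookup wide (∈-resp-↭ (↭-sym S↭) (here refl)))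
... | z , z≢x , z∈c with trace-back trail z (z≢x ∘ sym)
...   | inj₁ (A , B , refl , walk) = inj₁ (z , c ∷ A , step z≢x z∈c (entry trail) walk ,
  Unique-++ˡ (c ∷ A) (subst Unique (++-assoc (c ∷ A) B R) (Unique-resp-↭ S↭ uni)) ,
  All.tabulate λ a∈ → ∈-resp-↭ (↭-sym S↭) (∈-++⁺ˡ (∈-++⁺ˡ {xs = c ∷ A} a∈)))
...   | inj₂ z∉P with find-occurrence z R
...     | inj₂ z∉R = inj₂ (c , P ++ R , S↭ , z , z∈c , All.++⁺ z∉P z∉R)
cycle-or-removable zero uni wide trail R S↭ |R| | z , z≢x , z∈c | inj₂ z∉P | inj₁ (c′ , R′ , R↭ , z∈c′)
  with R | |R| | ↭-length R↭
... | [] | _ | ()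
cycle-or-removable (suc fuel) uni wide {x} {c} {P} trail R S↭ |R| | z , z≢x , z∈c | inj₂ z∉P | inj₁ (c′ , R′ , R↭ , z∈c′) =
  cycle-or-removable fuel uni wide (extend z∈c′ z∈c z≢x trail) R′
    (↭-trans S↭ (↭-trans (++⁺ˡ (c ∷ P) R↭)
      (shift c′ (c ∷ P) R′)))
    (≤-pred (subst (_≤ suc fuel) (↭-length R↭) |R|))

true-update : ∀ (σ : Assignment n) z b c → occurs z c ≡ false → TrueClause σ c → TrueClause (σ [ z ]≔ b) c
true-update σ z b c z∉c ((i , b′) , i∈c , σi) =
  (i , b′) , i∈c , trans (Vec.lookup∘update′ (occurs-≢ c (cong is-just i∈c) z∉c) σ b) σi

-- Induction on the number of clauses: after the others are satisfied, the private variable of the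
-- removed clause is reset to make it true, which affects no other clause.
cycle-or-satisfiable : ∀ fuel (S : List (Clause n)) → length S ≤ fuel → Unique S →
                       All (λ c → 2 ≤ width c) S → Cycle S ⊎ Satisfiable S
cycle-or-satisfiable fuel [] _ _ _ = inj₂ (replicate _ true , [])
cycle-or-satisfiable (suc fuel) S@(c ∷ R) (s≤s |R|) uni wide
  with some-variable c (≤-trans (s≤s z≤n) (All.head wide))
... | x , x∈c with cycle-or-removable (length R) uni wide (start x∈c) R ↭-refl ≤-refl
...   | inj₁ cycle = inj₁ cycle
...   | inj₂ (d , Q , S↭ , z , z∈d , z∉Q)
    with cycle-or-satisfiable fuel Q (≤-trans (≤-reflexive (suc-injective (sym (↭-length S↭)))) |R|)
           (unique-tail (Unique-resp-↭ S↭ uni)) (All.tail (All-resp-↭ S↭ wide))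
  where
  unique-tail : ∀ {x : X} {xs} → Unique (x ∷ xs) → Unique xs
  unique-tail (_ ∷ uni) = uni
...     | inj₁ (v , A , walk , uniA , A⊆Q) =
  inj₁ (v , A , walk , uniA , All.map (λ a∈ → ∈-resp-↭ (↭-sym S↭) (there a∈)) A⊆Q)
...     | inj₂ (σ , sat) with literal d z z∈d
...       | b , b∈d = inj₂ (σ [ z ]≔ b , All-resp-↭ (↭-sym S↭)
  (((z , b) , b∈d , Vec.lookup∘update z σ b) ∷
   All.zipWith (λ { {e} (z∉e , true-e) → true-update σ z b e z∉e true-e }) (z∉Q , sat)))

-- Counting cycles

-- Pascal's rule with two signs per variable. The factor `a` is 1, 2 or 4 according to whether no,
-- one or two variables are prescribed.
pascal₂ : ∀ k n a → a * 2 ^ᴺ suc k * (n C suc k) + (a * 2 ^ᴺ k * (n C k) + a * 2 ^ᴺ k * (n C k))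
          ≡ a * 2 ^ᴺ suc k * (suc n C suc k)
pascal₂ k n a = trans (eq a (2 ^ᴺ k) (n C suc k) (n C k))
  (cong (a * 2 ^ᴺ suc k *_) (nCk+nC[k+1]≡[n+1]C[k+1] n k))
  where
  eq : ∀ a t x y → a * (2 * t) * x + (a * t * y + a * t * y) ≡ a * (2 * t) * (y + x)
  eq = solve-∀

double : ∀ a t x → 0 + (a * t * x + a * t * x) ≡ 2 * a * t * x
double = solve-∀

count-all : ∀ k n → ∑ (λ _ → 1) (kClauses k n) ≡ 1 * 2 ^ᴺ k * (n C k)
count-all zero    zero    = refl
count-all (suc k) zero    = sym (trans (cong (1 * 2 ^ᴺ suc k *_) (k>n⇒nCk≡0 {0} {suc k} (s≤s z≤n))) (*-zeroʳ (1 * 2 ^ᴺ suc k)))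
count-all zero    (suc n) = trans (∑-kClauses-zero n _) (trans (count-all 0 n)
  (cong (1 * 1 *_) (trans (nC0≡1 n) (sym (nC0≡1 (suc n))))))
count-all (suc k) (suc n) = trans (∑-kClauses-suc k n _)
  (trans (cong₂ _+_ (count-all (suc k) n) (cong₂ _+_ (count-all k n) (count-all k n))) (pascal₂ k n 1))

none-occurs : ∀ {n} (y : Fin n) → hits (occurs y) (kClauses 0 n) ≡ 0
none-occurs {suc n} zero    = trans (∑-kClauses-zero n _) (∑-zero (kClauses 0 n))
none-occurs {suc n} (suc y) = trans (∑-kClauses-zero n _) (none-occurs y)

count-occurs : ∀ k {n} (y : Fin (suc n)) →
               hits (occurs y) (kClauses (suc k) (suc n)) ≡ 2 * 2 ^ᴺ k * (n C k)
count-occurs k {n} zero = trans (∑-kClauses-suc k n _)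
  (trans (cong₂ _+_ (∑-zero (kClauses (suc k) n)) (cong₂ _+_ (count-all k n) (count-all k n)))
    (double 1 (2 ^ᴺ k) (n C k)))
count-occurs zero {suc n} (suc y) = trans (∑-kClauses-suc 0 (suc n) _)
  (trans (cong₂ _+_ (count-occurs 0 y) (cong₂ _+_ (none-occurs y) (none-occurs y)))
    (trans (+-identityʳ _) (cong (2 * 1 *_) (trans (nC0≡1 n) (sym (nC0≡1 (suc n)))))))
count-occurs (suc k) {suc n} (suc y) = trans (∑-kClauses-suc (suc k) (suc n) _)
  (trans (cong₂ _+_ (count-occurs (suc k) y) (cong₂ _+_ (count-occurs k y) (count-occurs k y)))
    (pascal₂ k n 2))

both : ∀ {n} → Fin n → Fin n → Clause n → Bool
both y x c = occurs y c ∧ occurs x c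

both-comm : ∀ {n} (y x : Fin n) c → both y x c ≡ both x y c
both-comm y x c = Bool.∧-comm (occurs y c) (occurs x c)

not-both-0 : ∀ {n} (y x : Fin n) → hits (both y x) (kClauses 0 n) ≡ 0
not-both-0 y x = n≤0⇒n≡0 (≤-trans (∑-mono (kClauses 0 _) (λ {c} _ → first (occurs y c) (occurs x c)))
  (≤-reflexive (none-occurs y)))
  where
  first : ∀ a b → 𝟙 (a ∧ b) ≤ 𝟙 a
  first true  b = 𝟙≤1 b
  first false b = z≤n

not-both-1 : ∀ {n} (y x : Fin n) → y ≢ x → hits (both y x) (kClauses 1 n) ≡ 0
not-both-1 {suc n} zero    zero    y≢x = ⊥-elim (y≢x refl)
not-both-1 {suc n} zero    (suc x) y≢x = trans (∑-kClauses-suc 0 n _)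
  (cong₂ _+_ (∑-zero (kClauses 1 n)) (cong₂ _+_ (none-occurs x) (none-occurs x)))
not-both-1 {suc n} (suc y) zero    y≢x = trans (∑-cong (λ c → cong 𝟙 (both-comm (suc y) zero c)) (kClauses 1 (suc n)))
  (not-both-1 zero (suc y) λ ())
not-both-1 {suc n} (suc y) (suc x) y≢x = trans (∑-kClauses-suc 0 n _)
  (cong₂ _+_ (not-both-1 y x (y≢x ∘ cong suc)) (cong₂ _+_ (not-both-0 y x) (not-both-0 y x)))

-- Four sign patterns on `y` and `x`, times the k-clauses on the other n variables.
count-both : ∀ k {n} (y x : Fin (2 + n)) → y ≢ x →
             hits (both y x) (kClauses (2 + k) (2 + n)) ≡ 4 * 2 ^ᴺ k * (n C k)
count-both k {n} zero    zero    y≢x = ⊥-elim (y≢x refl)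
count-both k {n} zero    (suc x) y≢x = trans (∑-kClauses-suc (suc k) (suc n) _)
  (trans (cong₂ _+_ (∑-zero (kClauses (2 + k) (suc n))) (cong₂ _+_ (count-occurs k x) (count-occurs k x)))
    (double 2 (2 ^ᴺ k) (n C k)))
count-both k {n} (suc y) zero    y≢x =
  trans (∑-cong (λ c → cong 𝟙 (both-comm (suc y) zero c)) (kClauses (2 + k) (2 + n)))
    (count-both k zero (suc y) λ ())
count-both k {zero} (suc zero) (suc zero) y≢x = ⊥-elim (y≢x refl)
count-both zero {suc n} (suc y) (suc x) y≢x = trans (∑-kClauses-suc 1 (2 + n) _)
  (trans (cong₂ _+_ (count-both 0 y x y≢x′) (cong₂ _+_ (not-both-1 y x y≢x′) (not-both-1 y x y≢x′)))
    (trans (+-identityʳ _) (cong (4 * 1 *_) (trans (nC0≡1 n) (sym (nC0≡1 (suc n)))))))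
  where y≢x′ = y≢x ∘ cong suc
count-both (suc k) {suc n} (suc y) (suc x) y≢x = trans (∑-kClauses-suc (2 + k) (2 + n) _)
  (trans (cong₂ _+_ (count-both (suc k) y x y≢x′) (cong₂ _+_ (count-both k y x y≢x′) (count-both k y x y≢x′)))
    (pascal₂ k n 4))
  where y≢x′ = y≢x ∘ cong suc

-- Enumeration and total weight of closed walks

length≡∑ : ∀ (xs : List X) → length xs ≡ ∑ (λ _ → 1) xs
length≡∑ xs = sym (trans (∑-const 1 xs) (*-identityʳ (length xs)))

length-filter≡hits : ∀ {P : X → Set} (P? : Decidable P) xs → length (filter P? xs) ≡ hits (does ∘ P?) xs
length-filter≡hits P? xs = trans (length≡∑ (filter P? xs))
  (trans (∑-filter _ P? xs) (∑-cong (λ x → *-identityʳ (𝟙 (does (P? x)))) xs))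

length-concatMap-≤ : ∀ (f : X → List Y) a xs → (∀ x → length (f x) ≤ a) →
                     length (concatMap f xs) ≤ length xs * a
length-concatMap-≤ f a []       f≤a = z≤n
length-concatMap-≤ f a (x ∷ xs) f≤a = ≤-trans (≤-reflexive (length-++ (f x)))
  (+-mono-≤ (f≤a x) (length-concatMap-≤ f a xs f≤a))

length-× : ∀ (f : X → Y → Z) xs ys → length (cartesianProductWith f xs ys) ≡ length xs * length ys
length-× f []       ys = refl
length-× f (x ∷ xs) ys = trans (length-++ (map (f x) ys)) (cong₂ _+_ (length-map _ ys) (length-× f xs ys))

module Cycles (k n : ℕ) where

  board : List (Clause n)
  board = kClauses k n

  links : Fin n → Fin n → List (Clause n)
  links y x with y Fin.≟ x
  ... | yes _ = []
  ... | no  _ = filterᵇ (both y x) board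

  -- The index is one less than the number of clauses. Repeated clauses are allowed, so this
  -- overcounts, but the numbers become simple products.
  walks : ℕ → Fin n → Fin n → List (List (Clause n))
  walks zero    y z = map [_] (links y z)
  walks (suc s) y z = concatMap (λ x → cartesianProductWith _∷_ (links y x) (walks s x z)) (allFin n)

  closed : ℕ → List (List (Clause n))
  closed s = concatMap (λ z → walks s z z) (allFin n)

  cycles : ℕ → List (List (Clause n))
  cycles zero    = []
  cycles (suc L) = closed L ++ cycles L

  ∈-links : ∀ {y x c} → y ≢ x → occurs y c ≡ true → occurs x c ≡ true → c ∈ board → c ∈ links y x
  ∈-links {y} {x} {c} y≢x y∈c x∈c c∈ with y Fin.≟ x
  ... | yes y≡x = ⊥-elim (y≢x y≡x)
  ... | no  _   = ∈-filter⁺ _ c∈ (subst T (sym (cong₂ _∧_ y∈c x∈c)) _)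

  ∈-concatMap : ∀ (f : X → List Y) {x xs v} → x ∈ xs → v ∈ f x → v ∈ concatMap f xs
  ∈-concatMap f x∈ v∈ = ∈-concatMap⁺ f (Any.map (λ { refl → v∈ }) x∈)

  ∈-walks : ∀ {y z A} → Walk y z A → All (_∈ board) A → ∃ λ s → length A ≡ suc s × A ∈ walks s y z
  ∈-walks (last y≢z y∈c z∈c) (c∈ ∷ []) = 0 , refl , ∈-map⁺ [_] (∈-links y≢z y∈c z∈c c∈)
  ∈-walks (step {x = x} y≢x y∈c x∈c walk) (c∈ ∷ A∈) with ∈-walks walk A∈
  ... | s , |A| , A∈walks = suc s , cong suc |A| ,
    ∈-concatMap _ (∈-allFin x) (∈-cartesianProductWith⁺ _∷_ (∈-links y≢x y∈c x∈c c∈) A∈walks)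

  ∈-cycles : ∀ {L s A} → suc s ≤ L → A ∈ closed s → A ∈ cycles L
  ∈-cycles {suc L} {s} (s≤s s≤L) A∈ with m≤n⇒m<n∨m≡n s≤L
  ... | inj₁ s<L  = ∈-++⁺ʳ (closed L) (∈-cycles s<L A∈)
  ... | inj₂ refl = ∈-++⁺ˡ A∈

  length-walks : ∀ s y z {A} → A ∈ walks s y z → length A ≡ suc s
  length-walks zero    y z A∈ with ∈-map⁻ [_] A∈
  ... | _ , _ , refl = refl
  length-walks (suc s) y z A∈
    with Any.satisfied (∈-concatMap⁻ (λ x → cartesianProductWith _∷_ (links y x) (walks s x z)) {xs = allFin n} A∈)
  ... | x , A∈x with ∈-cartesianProductWith⁻ _∷_ (links y x) (walks s x z) A∈x
  ... | c , B , _ , B∈ , refl = cong suc (length-walks s x z B∈)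

  length-closed : ∀ s {A} → A ∈ closed s → length A ≡ suc s
  length-closed s A∈ with Any.satisfied (∈-concatMap⁻ (λ z → walks s z z) {xs = allFin n} A∈)
  ... | z , A∈z = length-walks s z z A∈z

  length-cycles : ∀ L {A} → A ∈ cycles L → length A ≤ L
  length-cycles (suc L) A∈ with ∈-++⁻ (closed L) A∈
  ... | inj₁ A∈closed = ≤-reflexive (length-closed L A∈closed)
  ... | inj₂ A∈cycles = m≤n⇒m≤1+n (length-cycles L A∈cycles)

  module Counting (D : ℕ) (links≤ : ∀ y x → length (links y x) ≤ D) where

    |Fin| : length (allFin n) ≡ n
    |Fin| = length-tabulate _

    -- There are s inner variables to choose and s + 1 clauses, each among at most `D`.
    walks≤ : ∀ s y z → length (walks s y z) ≤ (n * D) ^ᴺ s * D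
    walks≤ zero    y z = ≤-trans (≤-reflexive (length-map _ (links y z)))
      (≤-trans (links≤ y z) (≤-reflexive (sym (*-identityˡ D))))
    walks≤ (suc s) y z = ≤-trans (length-concatMap-≤ _ (D * ((n * D) ^ᴺ s * D)) (allFin n) λ x →
        ≤-trans (≤-reflexive (length-× _∷_ (links y x) (walks s x z))) (*-mono-≤ (links≤ y x) (walks≤ s x z)))
      (≤-reflexive (trans (cong (_* (D * ((n * D) ^ᴺ s * D))) |Fin|) (eq n D ((n * D) ^ᴺ s))))
      where
      eq : ∀ n D p → n * (D * (p * D)) ≡ n * D * p * D
      eq = solve-∀

    closed≤ : ∀ s → length (closed s) ≤ (n * D) ^ᴺ suc s
    closed≤ s = ≤-trans (length-concatMap-≤ _ _ (allFin n) λ z → walks≤ s z z)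
      (≤-reflexive (trans (cong (_* ((n * D) ^ᴺ s * D)) |Fin|) (eq n D ((n * D) ^ᴺ s))))
      where
      eq : ∀ n D p → n * (p * D) ≡ n * D * p
      eq = solve-∀

    module _ (q : ℕ) (1≤q : 1 ≤ q) (2nD≤q : 2 * (n * D) ≤ q) where

      -- The probability (q + 1)^(-|A|) of a random Client claiming all of `A`, scaled by (q + 1)^L.
      weight : ℕ → List (Clause n) → ℕ
      weight L A = suc q ^ᴺ (L ∸ length A)

      private
        -- The maximum with 1 keeps p^L positive, which makes the final bound strict.
        p = 1 ⊔ n * D

      2p≤ : 2 * p ≤ suc q
      2p≤ with ⊔-sel 1 (n * D)
      ... | inj₁ eq = ≤-trans (≤-reflexive (cong (2 *_) eq)) (s≤s 1≤q)
      ... | inj₂ eq = ≤-trans (≤-reflexive (cong (2 *_) eq)) (m≤n⇒m≤1+n 2nD≤q)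

      -- The summand p^L makes the geometric series inductive: the longest walks contribute at most
      -- p · p^L, and 2p · p^L ≤ (q + 1) p^L.
      weights : ∀ L → ∑ (weight L) (cycles L) + p ^ᴺ L ≤ suc q ^ᴺ L
      weights zero    = ≤-refl
      weights (suc L) = begin
        ∑ (weight (suc L)) (closed L ++ cycles L) + p * p ^ᴺ L
          ≡⟨ cong (_+ p * p ^ᴺ L) (∑-++ _ (closed L) (cycles L)) ⟩
        ∑ (weight (suc L)) (closed L) + ∑ (weight (suc L)) (cycles L) + p * p ^ᴺ L
          ≤⟨ +-monoˡ-≤ (p * p ^ᴺ L) (+-mono-≤ longest shorter) ⟩
        p * p ^ᴺ L + suc q * ∑ (weight L) (cycles L) + p * p ^ᴺ L
          ≡⟨ eq p (p ^ᴺ L) (suc q * ∑ (weight L) (cycles L)) ⟩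
        suc q * ∑ (weight L) (cycles L) + 2 * p * p ^ᴺ L
          ≤⟨ +-monoʳ-≤ (suc q * ∑ (weight L) (cycles L)) (*-monoˡ-≤ (p ^ᴺ L) 2p≤) ⟩
        suc q * ∑ (weight L) (cycles L) + suc q * p ^ᴺ L
          ≡⟨ *-distribˡ-+ (suc q) _ (p ^ᴺ L) ⟨
        suc q * (∑ (weight L) (cycles L) + p ^ᴺ L)
          ≤⟨ *-monoʳ-≤ (suc q) (weights L) ⟩
        suc q ^ᴺ suc L ∎
        where
        open ≤-Reasoning
        eq : ∀ p t s → p * t + s + p * t ≡ s + 2 * p * t
        eq = solve-∀
        longest : ∑ (weight (suc L)) (closed L) ≤ p * p ^ᴺ L
        longest = begin
          ∑ (weight (suc L)) (closed L)
            ≤⟨ ∑-bound _ 1 (closed L) (λ A∈ → ≤-reflexive (cong (suc q ^ᴺ_)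
                 (trans (cong (suc L ∸_) (length-closed L A∈)) (n∸n≡0 L)))) ⟩
          length (closed L) * 1     ≡⟨ *-identityʳ _ ⟩
          length (closed L)         ≤⟨ closed≤ L ⟩
          (n * D) ^ᴺ suc L          ≤⟨ ^-monoˡ-≤ (suc L) (m≤n⊔m 1 (n * D)) ⟩
          p * p ^ᴺ L                ∎
        shorter : ∑ (weight (suc L)) (cycles L) ≤ suc q * ∑ (weight L) (cycles L)
        shorter = begin
          ∑ (weight (suc L)) (cycles L)
            ≤⟨ ∑-mono (cycles L) (λ {A} A∈ → ≤-reflexive (cong (suc q ^ᴺ_) (+-∸-assoc 1 (length-cycles L A∈)))) ⟩
          ∑ (λ A → suc q * weight L A) (cycles L)
            ≡⟨ ∑-* (suc q) (weight L) (cycles L) ⟩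
          suc q * ∑ (weight L) (cycles L) ∎

      weights< : ∀ L → ∑ (weight L) (cycles L) < suc q ^ᴺ L
      weights< L = <-≤-trans (m<m+n _ (m^n>0 p {{>-nonZero (m≤m⊔n 1 (n * D))}} L)) (weights L)

-- Client's strategy on clauses

_≟ᶜ_ : ∀ {n} → DecidableEquality (Clause n)
_≟ᶜ_ = Vec.≡-dec (Maybe.≡-dec Bool._≟_)

Unique-length-≤ : ∀ {xs : List X} {ys} → Unique xs → All (_∈ ys) xs → length xs ≤ length ys
Unique-length-≤ []           []         = z≤n
Unique-length-≤ {xs = x ∷ xs} {ys} (x∉ ∷ uni) (x∈ ∷ xs⊆) with ∈-↭-∷ x∈
... | zs , ys↭ = ≤-trans (s≤s (Unique-length-≤ uni (All.zipWith (λ { (x≢y , y∈) → in-tail x≢y (∈-resp-↭ ys↭ y∈) }) (x∉ , xs⊆))))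
  (≤-reflexive (sym (↭-length ys↭)))
  where
  in-tail : ∀ {y} → x ≢ y → y ∈ x ∷ zs → y ∈ zs
  in-tail x≢y (here y≡x) = ⊥-elim (x≢y (sym y≡x))
  in-tail x≢y (there y∈) = y∈

-- A cycle claimed in full would alone have final weight at least (q + 1)^L, more than the initial
-- total of all weights.
client-wins : ∀ k n q → 2 ≤ k → 1 ≤ q →
  (D : ℕ) → (∀ (y x : Fin n) → y ≢ x → hits (both y x) (kClauses k n) ≤ D) → 2 * (n * D) ≤ q →
  ∃ λ (τ : ClientStrategy q (kClauses k n)) → ∀ S → Claim q τ S → Satisfiable S
client-wins k n q 2≤k 1≤q D both≤ 2nD≤q = τ , satisfiable
  where
  open Cycles k n
  links≤ : ∀ y x → length (links y x) ≤ D
  links≤ y x with y Fin.≟ x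
  ... | yes _   = z≤n
  ... | no  y≢x = ≤-trans (≤-reflexive (length-filter≡hits _ board)) (both≤ y x y≢x)
  open Counting D links≤
  open DecMembership _≟ᶜ_ using (_∈?_)
  -- A cycle consists of distinct clauses of the board, so it is no longer than this.
  L = length board
  κ = weight q 1≤q 2nD≤q L
  member : List (Clause n) → Clause n → Bool
  member A c = does (c ∈? A)
  open Avoidance member q
  strategy = avoid (cycles L) L board κ ≤-refl
  τ = proj₁ strategy
  no-cycle : ∀ S → Claim q τ S → ∀ A → A ∈ cycles L → Unique A → All (_∈ S) A → ⊥
  no-cycle S claim A A∈ uni A⊆S = <-irrefl refl (<-≤-trans (weights< q 1≤q 2nD≤q L) (begin
    suc q ^ᴺ L                                          ≡⟨ cong (suc q ^ᴺ_) (m∸n+n≡m (length-cycles L A∈)) ⟨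
    suc q ^ᴺ (L ∸ length A + length A)                  ≡⟨ ^-distribˡ-+-* (suc q) (L ∸ length A) (length A) ⟩
    κ A * suc q ^ᴺ length A                             ≤⟨ *-monoʳ-≤ (κ A) (^-monoʳ-≤ (suc q) many) ⟩
    κ A * suc q ^ᴺ hits (member A) S                    ≤⟨ proj₂ (proj₂ strategy S claim) A∈ (≤-trans few many) ⟩
    ∑ κ (cycles L)                                      ∎))
    where
    open ≤-Reasoning
    few : hits (member A) board ≤ length A
    few = ≤-trans (≤-reflexive (sym (length-filter≡hits (_∈? A) board)))
      (Unique-length-≤ (Unique.filter⁺ (_∈? A) (kClauses-unique k n))
        (All.tabulate λ c∈ → proj₂ (∈-filter⁻ (_∈? A) {xs = board} c∈)))
    many : length A ≤ hits (member A) S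
    many = ≤-trans (Unique-length-≤ uni (All.tabulate λ c∈ → ∈-filter⁺ (_∈? A) (All.lookup A⊆S c∈) c∈))
      (≤-reflexive (length-filter≡hits (_∈? A) S))
  satisfiable : ∀ S → Claim q τ S → Satisfiable S
  -- Satisfiability depends only on the set of claimed clauses, so repetitions are removed to obtain
  -- uniqueness.
  satisfiable S claim with cycle-or-satisfiable (length S′) S′ ≤-refl (DecUnique.deduplicate-! _≟ᶜ_ S) wide
    where
    S′ = deduplicate _≟ᶜ_ S
    wide : All (λ c → 2 ≤ width c) S′
    wide = All.tabulate λ c∈ → ≤-trans 2≤k (≤-reflexive (sym (Equivalence.to ∈-kClauses
      (All.lookup (claimed-free claim) (∈-deduplicate⁻ _≟ᶜ_ S c∈)))))
  ... | inj₂ (σ , sat) = σ , All.tabulate λ c∈ → All.lookup sat (∈-deduplicate⁺ _≟ᶜ_ c∈)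
  ... | inj₁ (z , A , walk , uni , A⊆S′) = ⊥-elim (no-cycle S claim A A∈cycles uni A⊆S)
    where
    A⊆S : All (_∈ S) A
    A⊆S = All.map (∈-deduplicate⁻ _≟ᶜ_ S) A⊆S′
    A⊆board : All (_∈ board) A
    A⊆board = All.map (All.lookup (claimed-free claim)) A⊆S
    A∈cycles : A ∈ cycles L
    A∈cycles with ∈-walks walk A⊆board
    ... | s , |A| , A∈ = ∈-cycles (subst (_≤ L) |A| (Unique-length-≤ uni A⊆board)) (∈-concatMap _ (∈-allFin z) A∈)

-- Binomial coefficients and the degree `D`

absorption : ∀ n k → suc k * (suc n C suc k) ≡ suc n * (n C k)
absorption n       zero    = trans (*-identityˡ _) (trans (C1 n) (sym (trans (cong (suc n *_) (nC0≡1 n)) (*-identityʳ (suc n)))))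
  where
  C1 : ∀ n → suc n C 1 ≡ suc n
  C1 n = nC1≡n (suc n)
absorption zero    (suc k) = trans (cong (suc (suc k) *_) (k>n⇒nCk≡0 {1} {2 + k} (s≤s (s≤s z≤n))))
  (trans (*-zeroʳ (2 + k)) (sym (trans (cong (1 *_) (k>n⇒nCk≡0 {0} {suc k} (s≤s z≤n))) refl)))
absorption (suc n) (suc k) = begin
  (2 + k) * ((2 + n) C (2 + k))                            ≡⟨ cong ((2 + k) *_) (nCk+nC[k+1]≡[n+1]C[k+1] (suc n) (suc k)) ⟨
  (2 + k) * (suc n C suc k + suc n C (2 + k))            ≡⟨ eq₁ k (suc n C suc k) (suc n C (2 + k)) ⟩
  suc n C suc k + (suc k * (suc n C suc k) + (2 + k) * (suc n C (2 + k)))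
    ≡⟨ cong ((suc n C suc k) +_) (cong₂ _+_ (absorption n k) (absorption n (suc k))) ⟩
  suc n C suc k + (suc n * (n C k) + suc n * (n C suc k))
    ≡⟨ cong ((suc n C suc k) +_) (trans (sym (*-distribˡ-+ (suc n) (n C k) (n C suc k)))
         (cong (suc n *_) (nCk+nC[k+1]≡[n+1]C[k+1] n k))) ⟩
  (2 + n) * (suc n C suc k)                            ∎
  where
  open ≡-Reasoning
  eq₁ : ∀ k x y → (2 + k) * (x + y) ≡ x + (suc k * x + (2 + k) * y)
  eq₁ = solve-∀

nCk>0 : ∀ {k n} → k ≤ n → 0 < n C k
nCk>0 {zero}  {n}     z≤n       = ≤-reflexive (sym (nC0≡1 n))
nCk>0 {suc k} {suc n} (s≤s k≤n) = ≤-trans (nCk>0 k≤n)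
  (subst (n C k ≤_) (nCk+nC[k+1]≡[n+1]C[k+1] n k) (m≤m+n _ _))

-- With K = 2 + k and M = 2 + n, absorption used twice gives C(M-2,K-2) = K(K-1)/(M(M-1)) · C(M,K),
-- and (K-1)/(M-1) ≤ K/M since K ≤ M.
degree-bound : ∀ k n q → k ≤ n → 2 * 2 ^ᴺ (2 + k) * ((2 + k) * (2 + k)) * ((2 + n) C (2 + k)) ≤ q * (2 + n) →
               2 * ((2 + n) * (4 * 2 ^ᴺ k * (n C k))) ≤ q
degree-bound k n q k≤n le = *-cancelʳ-≤ _ q (suc k) (begin
  2 * ((2 + n) * (4 * t * c)) * suc k         ≤⟨ ≤-trans (≤-reflexive (eq₁ n k t c)) (*-monoʳ-≤ (8 * t * c) mono) ⟩
  8 * t * c * ((2 + k) * suc n)               ≡⟨ eq₂ n k t c ⟩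
  8 * t * (2 + k) * (suc n * c)               ≡⟨ cong (8 * t * (2 + k) *_) (absorption n k) ⟨
  8 * t * (2 + k) * (suc k * c₁)              ≡⟨ eq₃ t k c₁ ⟩
  8 * t * (2 + k) * c₁ * suc k                ≤⟨ *-monoˡ-≤ (suc k) first ⟩
  q * suc k                                   ∎)
  where
  open ≤-Reasoning
  t = 2 ^ᴺ k
  c = n C k
  c₁ = suc n C suc k
  c₂ = (2 + n) C (2 + k)
  mono : (2 + n) * suc k ≤ (2 + k) * suc n
  mono with m≤n⇒∃[o]m+o≡n k≤n
  ... | d , refl = ≤-by d (eq k d)
    where
    eq : ∀ k d → (2 + (k + d)) * suc k + d ≡ (2 + k) * suc (k + d)
    eq = solve-∀
  eq₁ : ∀ n k t c → 2 * ((2 + n) * (4 * t * c)) * suc k ≡ 8 * t * c * ((2 + n) * suc k)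
  eq₁ = solve-∀
  eq₂ : ∀ n k t c → 8 * t * c * ((2 + k) * suc n) ≡ 8 * t * (2 + k) * (suc n * c)
  eq₂ = solve-∀
  eq₃ : ∀ t k c → 8 * t * (2 + k) * (suc k * c) ≡ 8 * t * (2 + k) * c * suc k
  eq₃ = solve-∀
  eq₄ : ∀ t k n c → 8 * t * (2 + k) * c * (2 + n) ≡ 8 * t * (2 + k) * ((2 + n) * c)
  eq₄ = solve-∀
  eq₅ : ∀ t k c → 8 * t * (2 + k) * ((2 + k) * c) ≡ 2 * (2 * (2 * t)) * ((2 + k) * (2 + k)) * c
  eq₅ = solve-∀
  first : 8 * t * (2 + k) * c₁ ≤ q
  first = *-cancelʳ-≤ _ q (2 + n) (begin
    8 * t * (2 + k) * c₁ * (2 + n)                       ≡⟨ eq₄ t k n c₁ ⟩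
    8 * t * (2 + k) * ((2 + n) * c₁)                     ≡⟨ cong (8 * t * (2 + k) *_) (absorption (suc n) (suc k)) ⟨
    8 * t * (2 + k) * ((2 + k) * c₂)                     ≡⟨ eq₅ t k c₂ ⟩
    2 * 2 ^ᴺ (2 + k) * ((2 + k) * (2 + k)) * c₂          ≤⟨ le ⟩
    q * (2 + n)                                          ∎)

-- Cuts

open import Data.Integer using (+_)
import Data.Integer as ℤ
import Data.Integer.Properties as ℤ
open import Data.Rational.Unnormalised as ℚ using (0ℚᵘ; _/_; ½; *≤*; *<*)
import Data.Rational.Unnormalised.Properties as ℚ

/-< : ∀ p d p₁ d₁ .{{_ : NonZero d}} .{{_ : NonZero d₁}} →
      p * d₁ < p₁ * d → + p / d ℚ.< + p₁ / d₁
/-< p (suc d) p₁ (suc d₁) lt = *<* (subst₂ ℤ._<_ (ℤ.pos-* p (suc d₁)) (ℤ.pos-* p₁ (suc d)) (ℤ.+<+ lt))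

/-≥0 : ∀ p d .{{_ : NonZero d}} → 0ℚᵘ ℚ.≤ + p / d
/-≥0 p (suc d) = *≤* (subst₂ ℤ._≤_ (ℤ.pos-* 0 (suc d)) (ℤ.pos-* p 1) (ℤ.+≤+ z≤n))

/-* : ∀ a d b d₁ .{{_ : NonZero d}} .{{_ : NonZero d₁}} →
      (+ a / d) ℚ.* (+ b / d₁) ≡ (+ (a * b) / (d * d₁)) {{m*n≢0 d d₁}}
/-* a (suc d) b (suc d₁) = cong (_/ (suc d * suc d₁)) (sym (ℤ.pos-* a b))

-- Rational witnesses a/d₁ and b/d₂ in the factors reduce membership in a product to an inequality
-- of natural numbers.
·-intro : ∀ {γ δ : Cut} a d₁ b d₂ p d .{{_ : NonZero d₁}} .{{_ : NonZero d₂}} .{{_ : NonZero d}} →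
          γ (+ a / d₁) → δ (+ b / d₂) → p * (d₁ * d₂) < a * b * d → (γ · δ) (+ p / d)
·-intro a d₁ b d₂ p d γa δb lt = inj₂ (_ , _ , /-≥0 a d₁ , γa , /-≥0 b d₂ , δb ,
  subst (+ p / d ℚ.<_) (sym (/-* a d₁ b d₂)) (/-< p d (a * b) (d₁ * d₂) {{_}} {{m*n≢0 d₁ d₂}} lt))

√-intro : ∀ {γ : Cut} a d .{{_ : NonZero d}} → γ ((+ (a * a) / (d * d)) {{m*n≢0 d d}}) → (√ γ) (+ a / d)
√-intro {γ} a d γaa = inj₂ (subst γ (sym (/-* a d a d)) γaa)

-- Multiplication of cuts is strict in both factors, so the power is bounded below by x (u₀/v₀)^m
-- with u₀/v₀ < u/v ∈ γ and x = x₁/x₂ < 1.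
module Powers {γ : Cut} (u v u₀ v₀ x₁ x₂ : ℕ)
  {{_ : NonZero v}} {{_ : NonZero u₀}} {{_ : NonZero v₀}} {{x₁≢0 : NonZero x₁}} {{x₂≢0 : NonZero x₂}}
  (γu : γ (+ u / v)) (u₀<u : u₀ * v < u * v₀) (x<1 : x₁ < x₂) where

  ^-intro : ∀ m p d .{{_ : NonZero d}} → p * (x₂ * v₀ ^ᴺ m) ≤ x₁ * u₀ ^ᴺ m * d → (γ ^ m) (+ p / d)
  -- The cut of 1 does not contain 1 itself; the factor x < 1 supplies the strictness.
  ^-intro zero p d le = /-< p d 1 1 (subst₂ _<_ (sym (*-identityʳ p)) (sym (*-identityˡ d))
    (*-cancelʳ-< x₂ p d (begin-strict
      p * x₂           ≡⟨ cong (p *_) (*-identityʳ x₂) ⟨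
      p * (x₂ * 1)     ≤⟨ le ⟩
      x₁ * 1 * d       ≡⟨ cong (_* d) (*-identityʳ x₁) ⟩
      x₁ * d           <⟨ *-monoˡ-< d x<1 ⟩
      x₂ * d           ≡⟨ *-comm x₂ d ⟩
      d * x₂           ∎)))
    where open ≤-Reasoning
  ^-intro (suc m) p d le =
    ·-intro {γ} {γ ^ m} u v (x₁ * u₀ ^ᴺ m) (x₂ * v₀ ^ᴺ m) p d {{_}} {{d≢0}} γu
      (^-intro m (x₁ * u₀ ^ᴺ m) (x₂ * v₀ ^ᴺ m) {{d≢0}} ≤-refl)
      (*-cancelʳ-< v₀ _ _ (begin-strict
        p * (v * (x₂ * v₀ ^ᴺ m)) * v₀        ≡⟨ eq₁ p v x₂ (v₀ ^ᴺ m) v₀ ⟩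
        p * (x₂ * (v₀ * v₀ ^ᴺ m)) * v        ≤⟨ *-monoˡ-≤ v le ⟩
        x₁ * (u₀ * u₀ ^ᴺ m) * d * v          ≡⟨ eq₂ x₁ u₀ (u₀ ^ᴺ m) d v ⟩
        x₁ * u₀ ^ᴺ m * d * (u₀ * v)          <⟨ *-monoʳ-< (x₁ * u₀ ^ᴺ m * d) {{m*n≢0 _ d {{n≢0}}}} u₀<u ⟩
        x₁ * u₀ ^ᴺ m * d * (u * v₀)          ≡⟨ eq₃ (x₁ * u₀ ^ᴺ m) d u v₀ ⟩
        u * (x₁ * u₀ ^ᴺ m) * d * v₀          ∎))
    where
    open ≤-Reasoning
    d≢0 : NonZero (x₂ * v₀ ^ᴺ m)
    d≢0 = m*n≢0 x₂ (v₀ ^ᴺ m) {{x₂≢0}} {{m^n≢0 v₀ m}}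
    n≢0 : NonZero (x₁ * u₀ ^ᴺ m)
    n≢0 = m*n≢0 x₁ (u₀ ^ᴺ m) {{x₁≢0}} {{m^n≢0 u₀ m}}
    eq₁ : ∀ p v x t w → p * (v * (x * t)) * w ≡ p * (x * (w * t)) * v
    eq₁ = solve-∀
    eq₂ : ∀ x u t d v → x * (u * t) * d * v ≡ x * t * d * (u * v)
    eq₂ = solve-∀
    eq₃ : ∀ y d u v → y * d * (u * v) ≡ u * y * d * v
    eq₃ = solve-∀

-- Numerical estimates for the constant

13/5<e : e (+ 13 / 5)
-- The partial sum 1 + 1 + 1/2 + 1/6 = 8/3 suffices.
13/5<e = 3 , from-yes (+ 13 / 5 ℚ.<? expSum 3)

-- For k = 2 + j this is k² ≤ 3/4 · (5/2)^k, with 5/2 < 13/5 < e, in the form `^-intro` takes. The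
-- induction uses 2(k + 1)² ≤ 5k² for k ≥ 2.
k²≤e^k : ∀ j → (2 + j) * (2 + j) * (4 * 2 ^ᴺ (2 + j)) ≤ 3 * 5 ^ᴺ (2 + j) * 1
k²≤e^k zero    = ≤ᵇ⇒≤ 64 75 _
k²≤e^k (suc j) = begin
  (3 + j) * (3 + j) * (4 * (2 * t))          ≤⟨ ≤-by _ (eq₁ j t) ⟩
  5 * ((2 + j) * (2 + j) * (4 * t))          ≤⟨ *-monoʳ-≤ 5 (k²≤e^k j) ⟩
  5 * (3 * 5 ^ᴺ (2 + j) * 1)                 ≡⟨ eq₂ (5 ^ᴺ (2 + j)) ⟩
  3 * (5 * 5 ^ᴺ (2 + j)) * 1                 ∎
  where
  open ≤-Reasoning
  t = 2 ^ᴺ (2 + j)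
  eq₁ : ∀ j t → (3 + j) * (3 + j) * (4 * (2 * t)) + (3 * j * j + 8 * j + 2) * (4 * t)
      ≡ 5 * ((2 + j) * (2 + j) * (4 * t))
  eq₁ = solve-∀
  eq₂ : ∀ f → 5 * (3 * f * 1) ≡ 3 * (5 * f) * 1
  eq₂ = solve-∀

-- For k = 2 + j this is (3/2 · 2^k)² ≤ 7/8 · (15/8)^(3k), where 15/8 is below 2 while its cube
-- 3375/512 exceeds 4.
9/4·4^k≤8^k : ∀ j → let t = 2 ^ᴺ (2 + j) in
  3 * t * (3 * t) * (8 * 8 ^ᴺ (3 * (2 + j))) ≤ 7 * 15 ^ᴺ (3 * (2 + j)) * (2 * 2)
9/4·4^k≤8^k j = subst₂ _≤_ (cong (λ x → 3 * t * (3 * t) * (8 * x)) (^-*-assoc 8 3 (2 + j)))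
                            (cong (λ x → 7 * x * (2 * 2)) (^-*-assoc 15 3 (2 + j))) (cubes j)
  where
  t = 2 ^ᴺ (2 + j)
  cubes : ∀ j → 3 * 2 ^ᴺ (2 + j) * (3 * 2 ^ᴺ (2 + j)) * (8 * 512 ^ᴺ (2 + j)) ≤ 7 * 3375 ^ᴺ (2 + j) * (2 * 2)
  cubes zero    = ≤ᵇ⇒≤ 301989888 318937500 _
  cubes (suc j) = begin
    3 * (2 * s) * (3 * (2 * s)) * (8 * (512 * x))  ≡⟨ eq₁ s x ⟩
    2048 * (3 * s * (3 * s) * (8 * x))             ≤⟨ *-mono-≤ (≤ᵇ⇒≤ 2048 3375 _) (cubes j) ⟩
    3375 * (7 * y * (2 * 2))                       ≡⟨ eq₂ y ⟩
    7 * (3375 * y) * (2 * 2)                       ∎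
    where
    open ≤-Reasoning
    s = 2 ^ᴺ (2 + j)
    x = 512 ^ᴺ (2 + j)
    y = 3375 ^ᴺ (2 + j)
    eq₁ : ∀ t x → 3 * (2 * t) * (3 * (2 * t)) * (8 * (512 * x)) ≡ 2048 * (3 * t * (3 * t) * (8 * x))
    eq₁ = solve-∀
    eq₂ : ∀ y → 3375 * (7 * y * (2 * 2)) ≡ 7 * (3375 * y) * (2 * 2)
    eq₂ = solve-∀

-- The constants are 3/2 · 2^k < 2^(3k/2), k < e^(k/2), 13/5 < e, 4k/5 < k and 4C/5n < C/n.
bias-bound : ∀ k → 2 ≤ k → ∀ n N q .{{_ : NonZero n}} .{{_ : NonZero N}} →
  √ (nat 2 ^ (3 * k)) · (√ (e ^ k) · e) · nat k · rat (+ N / n) ≤ᶜ (+ q / 1) →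
  2 * 2 ^ᴺ k * (k * k) * N ≤ q * n
bias-bound k 2≤k n N q q≥ with m≤n⇒∃[o]m+o≡n 2≤k | 2 * 2 ^ᴺ k * (k * k) * N ≤? q * n
... | _        | yes le = le
... | j , refl | no  nle = ⊥-elim (q≥
  -- From the inside outwards the products are bounded below by 12k/5, 7tk/2 and 5tk²/2, each with a
  -- little slack; the outermost bound 2tk²N/n exceeds q by `nle`.
  (·-intro {√ (nat 2 ^ (3 * k)) · (√ (e ^ k) · e) · nat k} {rat (+ N / n)} (5 * t * k * k) 2 (4 * N) (5 * n) q 1 {{_}} {{m*n≢0 5 n}}
    (·-intro {√ (nat 2 ^ (3 * k)) · (√ (e ^ k) · e)} {nat k} (7 * t * k) 2 (4 * k) 5 (5 * t * k * k) 2
      (·-intro {√ (nat 2 ^ (3 * k))} {√ (e ^ k) · e} (3 * t) 2 (12 * k) 5 (7 * t * k) 2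
        (√-intro {nat 2 ^ (3 * k)} (3 * t) 2
          (Powers.^-intro {nat 2} 19 10 15 8 7 8 (from-yes (+ 19 / 10 ℚ.<? + 2 / 1)) (≤ᵇ⇒≤ 151 152 _) ≤-refl
            (3 * k) (3 * t * (3 * t)) 4 (9/4·4^k≤8^k j)))
        (·-intro {√ (e ^ k)} {e} k 1 13 5 (12 * k) 5
          (√-intro {e ^ k} k 1 (Powers.^-intro {e} 13 5 5 2 3 4 13/5<e ≤-refl ≤-refl k (k * k) 1 (k²≤e^k j)))
          13/5<e
          (<-by k 4 (eq₁ k)))
        (<-by (t * k) {{tk≢0}} 1 (eq₂ t k)))
      (/-< (4 * k) 5 k 1 (<-by k 0 (eq₃ k)))
      (<-by (t * k * k) {{m*n≢0 (t * k) k {{tk≢0}}}} 5 (eq₄ t k)))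
    (/-< (4 * N) (5 * n) N n {{m*n≢0 5 n}} (<-by (N * n) {{m*n≢0 N n}} 0 (eq₅ N n)))
    (subst₂ _<_ (eq₆ q n) (eq₇ t k N) (*-monoʳ-< 10 (≰⇒> nle)))))
  where
  t = 2 ^ᴺ k
  tk≢0 : NonZero (t * k)
  tk≢0 = m*n≢0 t k {{m^n≢0 2 k}}
  <-by : ∀ {a b} c .{{_ : NonZero c}} r → a + suc r * c ≡ b → a < b
  <-by {a} (suc c) r eq = subst (a <_) eq (m<m+n a (s≤s z≤n))
  eq₁ : ∀ k → 12 * k * (1 * 5) + 5 * k ≡ k * 13 * 5
  eq₁ = solve-∀
  eq₂ : ∀ t k → 7 * t * k * (2 * 5) + 2 * (t * k) ≡ 3 * t * (12 * k) * 2
  eq₂ = solve-∀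
  eq₃ : ∀ k → 4 * k * 1 + 1 * k ≡ k * 5
  eq₃ = solve-∀
  eq₄ : ∀ t k → 5 * t * k * k * (2 * 5) + 6 * (t * k * k) ≡ 7 * t * k * (4 * k) * 2
  eq₄ = solve-∀
  eq₅ : ∀ N n → 4 * N * n + 1 * (N * n) ≡ N * (5 * n)
  eq₅ = solve-∀
  eq₆ : ∀ q n → 10 * (q * n) ≡ q * (2 * (5 * n))
  eq₆ = solve-∀
  eq₇ : ∀ t k N → 10 * (2 * t * (k * k) * N) ≡ 5 * t * k * k * (4 * N) * 1
  eq₇ = solve-∀

half-bound : ∀ n N q .{{_ : NonZero n}} → (+ q / 1) ℚ.≤ ½ ℚ.* (+ N / n) → 2 * n * q ≤ N
half-bound (suc n) N q le with ℚ.drop-*≤* le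
... | le′ = subst₂ _≤_ (*-comm q (2 * suc n)) (trans (*-identityʳ _) (*-identityˡ N))
  (ℤ.drop‿+≤+ (subst₂ ℤ._≤_ (sym (ℤ.pos-* q (2 * suc n)))
    (trans (cong (ℤ._* + 1) (sym (ℤ.pos-* 1 N))) (sym (ℤ.pos-* (1 * N) 1))) le′))

theorem1p4 : ∀ (k : ℕ) → 2 ≤ k →
    ∃ λ (n₀ : ℕ) → ∀ (n : ℕ) .{{_ : NonZero n}} → n₀ ≤ n → ∀ (q : ℕ) → 1 ≤ q →
    ((+ q / 1) ℚ.≤ ½ ℚ.* (+ (n C k) / n) →
    ∃ λ (σ : WaiterStrategy q (kClauses k n)) →
    ∀ (S : List (Clause n)) → FinalClaim q σ S → ¬ Satisfiable S)
    ×
    (√ (nat 2 ^ (3 * k)) · (√ (e ^ k) · e) · nat k · rat (+ (n C k) / n) ≤ᶜ (+ q / 1) →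
    ∃ λ (τ : ClientStrategy q (kClauses k n)) →
    ∀ (S : List (Clause n)) → Claim q τ S → Satisfiable S)
theorem1p4 (suc zero) (s≤s ())
-- The summand 166 serves Waiter's estimate, and k ensures n ≥ k and hence a positive C(n,k) for
-- Client's.
theorem1p4 k@(suc (suc k′)) 2≤k = 166 + k , λ where
  (suc zero) (s≤s ())
  n@(suc (suc n′)) n₀≤n q 1≤q → let k≤n = ≤-trans (m≤n+m k 166) n₀≤n in
    (λ q≤ → waiter-wins k n q 1≤q (≤-trans (m≤m+n 166 k) n₀≤n) (half-bound n (n C k) q q≤)) ,
    (λ q≥ → client-wins k n q 2≤k 1≤q (4 * 2 ^ᴺ k′ * (n′ C k′))
      (λ y x y≢x → ≤-reflexive (count-both k′ y x y≢x))
      (degree-bound k′ n′ q (≤-pred (≤-pred k≤n))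
        (bias-bound k 2≤k n (n C k) q {{_}} {{>-nonZero (nCk>0 k≤n)}} q≥)))
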